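{- The optimal deterministic competitive ratio for offline-vertex-weighted $\mathrm{WOMP}_3(1,1)$ is exactly $2-\sqrt2$. More precisely, there is a deterministic online algorithm for $\mathrm{WOMP}_3(1,1)$ with competitive ratio $2-\sqrt2$, and no deterministic online algorithm for $\mathrm{WOMP}_3(1,1)$ can achieve a larger competitive ratio.
   Context: Offline-vertex-weighted online bipartite matching: an instance $(G,\pi,w)$ is a finite bipartite graph $G=(L,R,E)$, an arrival order $\pi$ of $R$, and weights $w:L\to\mathbb R_{\ge0}$. The offline side $L$ and $w$ are known in advance; online vertices $j\in R$ arrive one by one in order $\pi$, and upon arrival of $j$ all edges incident to $j$ are revealed. The algorithm maintains a matching $M$, initially empty. A vertex is free if it is currently unmatched. The objective is the total weight of the matched offline vertices. $\mathrm{WOMP}_3(s,t)$ for $s,t\in\mathbb N\cup\{\infty\}$: upon arrival of $j$, the algorithm either leaves $j$ unmatched (forever, unless matched at this moment) or augments the current matching along an augmenting path of length $1$ or $3$ that starts at $j$ and ends at a free vertex of $L$. A length-1 path $[j~i]$ adds $ji$ with $i\in L$ free. A length-3 path $[j~x~y~i]$, with $x,i\in L$, $y\in R$, $xy\in M$, $i$ free, $jx,yi\in E$, replaces $M$ by $(M\setminus\{xy\})\cup\{jx,yi\}$; then $x$ and $y$ are each said to be reassigned once. Over the execution, each vertex of $L$ may be reassigned at most $s$ times and each vertex of $R$ at most $t$ times. A deterministic online algorithm is $\rho$-competitive if for every instance the total offline weight of its final matching is at least $\rho$ times the maximum total offline weight of a matching in $G$; its competitive ratio is the largest such $\rho$ (supremum).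 -}

module Defs where

open import Algebra.Core using (Op₁; Op₂)
open import Algebra.Structures using (IsCommutativeRing)
import Algebra.Definitions.RawMonoid as RawMonoidOps
open import Algebra.Bundles.Raw using (RawMonoid)
open import Data.Bool using (if_then_else_)
open import Data.Fin using (Fin)
open import Data.Fin.Permutation using (Permutation′; _⟨$⟩ʳ_)
open import Data.Fin.Subset using (Subset; _∈_)
open import Data.List using (List; []; _∷_; tabulate)
open import Data.Maybe using (Maybe; just; nothing; is-just)
open import Data.Nat using (ℕ; suc; _<_)
open import Data.Product using (∃; ∃-syntax; _×_; proj₁)
open import Data.Vec using (Vec; lookup; replicate; _[_]≔_; _[_]%=_)
open import Level using (0ℓ)
open import Relation.Binary.Core using (Rel)
open import Relation.Binary.PropositionalEquality using (_≡_; _≢_)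
open import Relation.Binary.Structures using (IsDecTotalOrder)

-- The classical real numbers, given by the axioms of a complete ordered
-- field, which determine them up to isomorphism.  Decidability of the order
-- is the classical trichotomy.

record RealNumbers : Set₁ where
  infix  8 -_
  infixl 7 _*_
  infixl 6 _+_ _-_
  infix  4 _≤_
  field
    ℝ     : Set
    _+_   : Op₂ ℝ
    _*_   : Op₂ ℝ
    -_    : Op₁ ℝ
    0#    : ℝ
    1#    : ℝ
    _≤_   : Rel ℝ 0ℓ

    isCommutativeRing : IsCommutativeRing _≡_ _+_ _*_ -_ 0# 1#
    0≢1               : 0# ≢ 1#
    inverse           : ∀ x → x ≢ 0# → ∃[ y ] x * y ≡ 1#

    isDecTotalOrder   : IsDecTotalOrder _≡_ _≤_
    +-monoˡ-≤         : ∀ z {x y} → x ≤ y → x + z ≤ y + z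
    *-nonNegative     : ∀ {x y} → 0# ≤ x → 0# ≤ y → 0# ≤ x * y

  IsUpperBound : (ℝ → Set) → ℝ → Set
  IsUpperBound P b = ∀ x → P x → x ≤ b

  IsLeastUpperBound : (ℝ → Set) → ℝ → Set
  IsLeastUpperBound P b = IsUpperBound P b × (∀ c → IsUpperBound P c → b ≤ c)

  field
    complete : (P : ℝ → Set) → ∃ P → ∃ (IsUpperBound P) → ∃ (IsLeastUpperBound P)

  _-_ : Op₂ ℝ
  x - y = x + (- y)

  2# : ℝ
  2# = 1# + 1#

  +-rawMonoid : RawMonoid 0ℓ 0ℓ
  +-rawMonoid = record { Carrier = ℝ ; _≈_ = _≡_ ; _∙_ = _+_ ; ε = 0# }

  sum : ∀ {n} → (Fin n → ℝ) → ℝ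
  sum = RawMonoidOps.sum +-rawMonoid

-- A bipartite graph with L = Fin l and R = Fin r; `N j` is the set of
-- neighbours in L of the vertex j of R.

record BipartiteGraph (l r : ℕ) : Set where
  field
    N : Fin r → Subset l

-- A set of edges in which each vertex of L has at most one edge is stored as
-- the vector of partners of the vertices of L.

Mates : ℕ → ℕ → Set
Mates l r = Vec (Maybe (Fin r)) l

record IsMatching {l r : ℕ} (G : BipartiteGraph l r) (M : Mates l r) : Set where
  open BipartiteGraph G
  field
    edge      : ∀ {i j} → lookup M i ≡ just j → i ∈ N j
    injective : ∀ {i i′ j} → lookup M i ≡ just j → lookup M i′ ≡ just j → i ≡ i′

-- What an algorithm may do when j arrives: leave j unmatched, augment along
-- [j i], or augment along [j x y i].  In the last case y is not named because
-- it can only be the current partner of x.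

data Decision (l : ℕ) : Set where
  leave    : Decision l
  augment₁ : (i : Fin l) → Decision l
  augment₃ : (x i : Fin l) → Decision l

record State (l r : ℕ) : Set where
  constructor state
  field
    M           : Mates l r
    reassignedL : Vec ℕ l
    reassignedR : Vec ℕ r

initial : ∀ {l r} → State l r
initial {l} {r} = state (replicate l nothing) (replicate l 0) (replicate r 0)

-- `Step s t G j σ d σ′`: on the arrival of j in state σ, the decision d is
-- allowed by WOMP₃(s,t) and leads to σ′.

data Step (s t : ℕ) {l r : ℕ} (G : BipartiteGraph l r) (j : Fin r) :
          State l r → Decision l → State l r → Set where

  leave : ∀ {σ} → Step s t G j σ leave σ

  augment₁ : ∀ {M cL cR i} →
    i ∈ BipartiteGraph.N G j →
    lookup M i ≡ nothing →
    Step s t G j (state M cL cR) (augment₁ i) (state (M [ i ]≔ just j) cL cR)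

  augment₃ : ∀ {M cL cR x y i} →
    x ∈ BipartiteGraph.N G j →
    lookup M x ≡ just y →
    i ∈ BipartiteGraph.N G y →
    lookup M i ≡ nothing →
    lookup cL x < s →
    lookup cR y < t →
    Step s t G j (state M cL cR) (augment₃ x i)
      (state ((M [ x ]≔ just j) [ i ]≔ just y) (cL [ x ]%= suc) (cR [ y ]%= suc))

module WOMP₃ (reals : RealNumbers) (s t : ℕ) where
  open RealNumbers reals

  record Instance : Set where
    field
      {l r}       : ℕ
      G           : BipartiteGraph l r
      π           : Permutation′ r
      w           : Vec ℝ l
      nonNegative : ∀ i → 0# ≤ lookup w i

    open BipartiteGraph G public

    -- `π ⟨$⟩ʳ k` is the k-th vertex of R to arrive.
    arrivals : List (Fin r)
    arrivals = tabulate (π ⟨$⟩ʳ_)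

    weight : Mates l r → ℝ
    weight M = sum (λ i → if is-just (lookup M i) then lookup w i else 0#)

    IsMaximumMatching : Mates l r → Set
    IsMaximumMatching M =
      IsMatching G M × (∀ M′ → IsMatching G M′ → weight M′ ≤ weight M)

  -- A decision depends on the weights (hence on L), on the neighbourhoods of
  -- the earlier arrivals (latest first), and on that of the current arrival.
  -- Neither r nor later arrivals are visible.  The algorithm's own earlier
  -- decisions are determined by the same data.

  Policy : Set
  Policy = ∀ {l} → Vec ℝ l → List (Subset l) → Subset l → Decision l

  -- `Execution decide I past σ js σ′`: after the neighbourhoods in `past`,
  -- starting in σ, the arrivals js lead to σ′.
  module _ (decide : Policy) (I : Instance) where
    open Instance I

    data Execution : List (Subset l) → State l r → List (Fin r) → State l r → Set where
      done   : ∀ {past σ} → Execution past σ [] σ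
      arrive : ∀ {past σ j σ₁ js σ₂} →
        Step s t G j σ (decide w past (N j)) σ₁ →
        Execution (N j ∷ past) σ₁ js σ₂ →
        Execution past σ (j ∷ js) σ₂

  record Algorithm : Set where
    field
      decide : Policy
      legal  : ∀ I → ∃ (Execution decide I [] initial (Instance.arrivals I))

    -- Steps are deterministic, so the final state is the only one reachable.
    final : ∀ I → Mates (Instance.l I) (Instance.r I)
    final I = State.M (proj₁ (legal I))

  Competitive : Algorithm → ℝ → Set
  Competitive A ρ = ∀ I M → Instance.IsMaximumMatching I M →
    ρ * Instance.weight I M ≤ Instance.weight I (Algorithm.final A I)

  -- The supremum of the set of such ρ is attained, as the set is closed.
  IsCompetitiveRatio : Algorithm → ℝ → Set
  IsCompetitiveRatio A ρ = Competitive A ρ × (∀ ρ′ → Competitive A ρ′ → ρ′ ≤ ρ)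

{-# OPTIONS --safe #-}

-- Put δ = √2 − 1 and κ = 2 − √2, so that (1 + δ) δ = κ = 1 − δ and (2 + δ) δ = 1.
--
-- The algorithm compares the heaviest free neighbour a of the arriving vertex
-- with the heaviest vertex b reachable by a path of length 3, and reroutes only
-- if w(a) ≤ δ w(b).  Every gained weight is charged to R: a direct match of j
-- with a charges w(a) to j; a rerouting [j x y b] charges κ w(b) to j and
-- δ w(b) to y.  In the end each pair (i , j), matched and never reassigned,
-- passes δ m from i to j, m being the largest weight of a free neighbour of j.
-- Then (1 + δ) w(i) on the matched vertices of L and the charges on R, corrected
-- by these transfers, form a feasible dual solution for the weights (1 + δ) w of
-- value (2 + δ) w(M), which is the claimed ratio.
--
-- The adversary uses weights 1, 1, 1, δ.  The first vertex sees the three heavy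
-- vertices and the second sees the vertex x matched by the first, and the light
-- one.  If the algorithm reroutes the first vertex to i, then vertices seeing
-- only x and only i follow and gain nothing: 2 against 3 + δ.  Otherwise a vertex
-- seeing only the light vertex follows: at most 1 + δ against 2 + δ.
module Submission where

open import Defs
open import Algebra.Bundles using (CommutativeRing)
open import Data.Bool using (true; false; if_then_else_)
import Data.Bool.Properties as Bool
open import Data.Fin using (Fin; zero; suc)
open import Data.Fin.Patterns using (0F; 1F; 2F; 3F)
open import Data.Fin.Permutation as Permutation using (_⟨$⟩ʳ_; _⟨$⟩ˡ_; inverseʳ)
import Data.Fin.Properties as Fin
open import Data.Fin.Subset using (Subset; inside; outside; _∈_; ⁅_⁆; _∪_)
open import Data.Fin.Subset.Properties using (_∈?_; x∈⁅y⁆⇒x≡y; x∈p∪q⁻)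
open import Data.List using (List; []; _∷_; allFin; cartesianProduct)
import Data.List.Membership.Propositional as List
open import Data.List.Membership.Propositional.Properties
  using (∈-allFin; ∈-cartesianProduct⁺; ∈-tabulate⁺)
import Data.List.Relation.Unary.All.Properties as All
open import Data.List.Relation.Unary.AllPairs using ([]; _∷_)
open import Data.List.Relation.Unary.Any using (here; there)
open import Data.List.Relation.Unary.Unique.Propositional using (Unique)
import Data.List.Relation.Unary.Unique.Propositional.Properties as Unique
open import Data.Maybe using (just; nothing; is-just)
open import Data.Maybe.Properties using (≡-dec; just-injective)
open import Data.Nat as ℕ using (ℕ; s≤s)
import Data.Nat.Properties as ℕ
open import Data.Product using (Σ-syntax; ∃-syntax; _×_; _,_; proj₁; proj₂)
open import Data.Sum using (_⊎_; inj₁; inj₂)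
open import Data.Vec using (Vec; []; _∷_; here; there; lookup; replicate; _[_]≔_; _[_]%=_)
open import Data.Vec.Properties
  using (lookup∘update; lookup∘update′; lookup∘updateAt; lookup∘updateAt′; lookup-replicate)
open import Function using (_∘_)
open import Function.Bundles using (module Injection)
open import Function.Properties.Inverse using (↔⇒↣)
open import Level using (0ℓ)
open import Relation.Binary.Bundles using (DecTotalOrder)
open import Relation.Binary.PropositionalEquality
  using (_≡_; _≢_; refl; sym; trans; cong; subst; subst₂)
open import Relation.Nullary
  using (¬_; ¬?; Dec; does; yes; no; contradiction; map′; _×-dec_; _→-dec_; from-yes)

-- The ordered field and √2

module OrderedField (reals : RealNumbers) where
  open RealNumbers reals

  commutativeRing : CommutativeRing 0ℓ 0ℓ
  commutativeRing = record { isCommutativeRing = isCommutativeRing }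

  decTotalOrder : DecTotalOrder 0ℓ 0ℓ 0ℓ
  decTotalOrder = record { isDecTotalOrder = isDecTotalOrder }

  open CommutativeRing commutativeRing public
    using ( +-assoc; +-comm; +-identityˡ; +-identityʳ; -‿inverseˡ; -‿inverseʳ
          ; *-assoc; *-comm; *-identityˡ; *-identityʳ; distribˡ; zeroˡ; zeroʳ
          ; ring; semiring; commutativeSemiring )
  open import Algebra.Properties.Ring ring public using (+-cancelˡ; -‿distribʳ-*; -‿involutive)
  open import Algebra.Solver.Ring.NaturalCoefficients.Default commutativeSemiring public
    using (solve; _:+_; _:*_; _:=_; con)
  open DecTotalOrder decTotalOrder public
    using (total; antisym; _≟_)
    renaming (refl to ≤-refl; reflexive to ≤-reflexive; trans to ≤-trans)
  open import Relation.Binary.Reasoning.PartialOrder (DecTotalOrder.poset decTotalOrder) public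

  +-monoʳ-≤ : ∀ z {x y} → x ≤ y → z + x ≤ z + y
  +-monoʳ-≤ z {x} {y} x≤y = subst₂ _≤_ (+-comm x z) (+-comm y z) (+-monoˡ-≤ z x≤y)

  +-mono-≤ : ∀ {x y u v} → x ≤ y → u ≤ v → x + u ≤ y + v
  +-mono-≤ {y = y} {u} x≤y u≤v = ≤-trans (+-monoˡ-≤ u x≤y) (+-monoʳ-≤ y u≤v)

  x+[y-x]≡y : ∀ x y → x + (y - x) ≡ y
  x+[y-x]≡y x y = begin-equality
    x + (y - x)    ≡⟨ +-comm x (y - x) ⟩
    y + - x + x    ≡⟨ +-assoc y (- x) x ⟩
    y + (- x + x)  ≡⟨ cong (y +_) (-‿inverseˡ x) ⟩
    y + 0#         ≡⟨ +-identityʳ y ⟩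
    y              ∎

  x≤y⇒0≤y-x : ∀ {x y} → x ≤ y → 0# ≤ y - x
  x≤y⇒0≤y-x {x} {y} x≤y = subst (_≤ y - x) (-‿inverseʳ x) (+-monoˡ-≤ (- x) x≤y)

  *-monoˡ-≤ : ∀ {z x y} → 0# ≤ z → x ≤ y → z * x ≤ z * y
  *-monoˡ-≤ {z} {x} {y} 0≤z x≤y = begin
    z * x                ≡⟨ +-identityʳ _ ⟨
    z * x + 0#           ≤⟨ +-monoʳ-≤ _ (*-nonNegative 0≤z (x≤y⇒0≤y-x x≤y)) ⟩
    z * x + z * (y - x)  ≡⟨ distribˡ z x (y - x) ⟨
    z * (x + (y - x))    ≡⟨ cong (z *_) (x+[y-x]≡y x y) ⟩
    z * y                ∎

  *-monoʳ-≤ : ∀ {z x y} → 0# ≤ z → x ≤ y → x * z ≤ y * z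
  *-monoʳ-≤ {z} {x} {y} 0≤z x≤y = subst₂ _≤_ (*-comm z x) (*-comm z y) (*-monoˡ-≤ 0≤z x≤y)

  +-nonNegative : ∀ {x y} → 0# ≤ x → 0# ≤ y → 0# ≤ x + y
  +-nonNegative {x} {y} 0≤x 0≤y = subst (_≤ x + y) (+-identityˡ 0#) (+-mono-≤ 0≤x 0≤y)

  x≤x+y : ∀ {x y} → 0# ≤ y → x ≤ x + y
  x≤x+y {x} {y} 0≤y = subst (_≤ x + y) (+-identityʳ x) (+-monoʳ-≤ x 0≤y)

  x≤y+x : ∀ {x y} → 0# ≤ y → x ≤ y + x
  x≤y+x {x} {y} 0≤y = subst (x ≤_) (+-comm x y) (x≤x+y 0≤y)

  +-cancelˡ-≤ : ∀ z {x y} → z + x ≤ z + y → x ≤ y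
  +-cancelˡ-≤ z {x} {y} z+x≤z+y = subst₂ _≤_ (cancel x) (cancel y) (+-monoʳ-≤ (- z) z+x≤z+y)
    where
    cancel : ∀ u → - z + (z + u) ≡ u
    cancel u = begin-equality
      - z + (z + u)  ≡⟨ +-assoc (- z) z u ⟨
      - z + z + u    ≡⟨ cong (_+ u) (-‿inverseˡ z) ⟩
      0# + u         ≡⟨ +-identityˡ u ⟩
      u              ∎

  0≤1 : 0# ≤ 1#
  0≤1 with total 0# 1#
  ... | inj₁ 0≤1 = 0≤1
  ... | inj₂ 1≤0 = subst (0# ≤_) [-1][-1]≡1 (*-nonNegative 0≤-1 0≤-1)
    where
    0≤-1 : 0# ≤ - 1#
    0≤-1 = subst (0# ≤_) (+-identityˡ (- 1#)) (x≤y⇒0≤y-x 1≤0)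
    [-1][-1]≡1 : - 1# * - 1# ≡ 1#
    [-1][-1]≡1 = begin-equality
      - 1# * - 1#    ≡⟨ -‿distribʳ-* (- 1#) 1# ⟨
      - (- 1# * 1#)  ≡⟨ cong -_ (*-identityʳ (- 1#)) ⟩
      - - 1#         ≡⟨ -‿involutive 1# ⟩
      1#             ∎

  0≤2 : 0# ≤ 2#
  0≤2 = +-nonNegative 0≤1 0≤1

  1≤x⇒x≢0 : ∀ {x} → 1# ≤ x → x ≢ 0#
  1≤x⇒x≢0 1≤0 refl = 0≢1 (antisym 0≤1 1≤0)

  inverse-nonNegative : ∀ {x y} → 0# ≤ x → x * y ≡ 1# → 0# ≤ y
  inverse-nonNegative {x} {y} 0≤x xy≡1 with total 0# y
  ... | inj₁ 0≤y = 0≤y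
  ... | inj₂ y≤0 = contradiction refl (1≤x⇒x≢0 (subst₂ _≤_ xy≡1 (zeroʳ x) (*-monoˡ-≤ 0≤x y≤0)))

  *-cancelˡ-≤ : ∀ {z x y} → 0# ≤ z → z ≢ 0# → z * x ≤ z * y → x ≤ y
  *-cancelˡ-≤ {z} {x} {y} 0≤z z≢0 zx≤zy with inverse z z≢0
  ... | v , zv≡1 = subst₂ _≤_ (cancel x) (cancel y) (*-monoˡ-≤ (inverse-nonNegative 0≤z zv≡1) zx≤zy)
    where
    cancel : ∀ u → v * (z * u) ≡ u
    cancel u = begin-equality
      v * (z * u)  ≡⟨ solve 3 (λ v z u → v :* (z :* u) := z :* v :* u) refl v z u ⟩
      z * v * u    ≡⟨ cong (_* u) zv≡1 ⟩
      1# * u       ≡⟨ *-identityˡ u ⟩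
      u            ∎

  x+x≤y+y⇒x≤y : ∀ {x y} → x + x ≤ y + y → x ≤ y
  x+x≤y+y⇒x≤y {x} {y} x+x≤y+y =
    *-cancelˡ-≤ 0≤2 (1≤x⇒x≢0 (x≤x+y 0≤1)) (subst₂ _≤_ (double x) (double y) x+x≤y+y)
    where
    double : ∀ u → u + u ≡ 2# * u
    double = solve 1 (λ u → u :+ u := con 2 :* u) refl

  square-cancel-≤ : ∀ {x y} → 0# ≤ y → x * x ≤ y * y → x ≤ y
  square-cancel-≤ {x} {y} 0≤y xx≤yy with total x y
  ... | inj₁ x≤y = x≤y
  ... | inj₂ y≤x with x ≟ 0#
  ...   | yes refl = 0≤y
  -- Here y ≤ x gives x x ≤ y y ≤ x y, and the nonzero x cancels.
  ...   | no x≢0 = *-cancelˡ-≤ (≤-trans 0≤y y≤x) x≢0 (≤-trans xx≤yy (*-monoʳ-≤ 0≤y y≤x))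

  -- For s = sup {x | x² ≤ 2} and t = (2 s + 2) / (s + 2) one has
  -- t² − 2 = 2 (s² − 2) / (s + 2)² and t − s = (2 − s²) / (s + 2), so
  -- s² < 2 would make t a larger member, and s² > 2 a smaller upper bound.
  √2-exists : ∃[ s ] 0# ≤ s × s * s ≡ 2#
  √2-exists
    with complete (λ x → x * x ≤ 2#)
           (1# , subst (_≤ 2#) (sym (*-identityˡ 1#)) (x≤x+y 0≤1))
           (2# , λ x xx≤2 → square-cancel-≤ 0≤2 (≤-trans xx≤2 2≤2*2))
    where
    2≤2*2 : 2# ≤ 2# * 2#
    2≤2*2 = subst (_≤ 2# * 2#) (*-identityʳ 2#) (*-monoˡ-≤ 0≤2 (x≤x+y 0≤1))
  ... | s , upper , least = s , 0≤s , ss≡2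
    where
    0≤s : 0# ≤ s
    0≤s = upper 0# (subst (_≤ 2#) (sym (zeroˡ 0#)) 0≤2)
    0≤s+2 : 0# ≤ s + 2#
    0≤s+2 = +-nonNegative 0≤s 0≤2
    s+2≢0 : s + 2# ≢ 0#
    s+2≢0 = 1≤x⇒x≢0 (≤-trans (x≤x+y 0≤1) (x≤y+x 0≤s))
    v = proj₁ (inverse (s + 2#) s+2≢0)
    [s+2]v≡1 : (s + 2#) * v ≡ 1#
    [s+2]v≡1 = proj₂ (inverse (s + 2#) s+2≢0)
    0≤v : 0# ≤ v
    0≤v = inverse-nonNegative 0≤s+2 [s+2]v≡1
    t = (2# * s + 2#) * v
    0≤t : 0# ≤ t
    0≤t = *-nonNegative (+-nonNegative (*-nonNegative 0≤2 0≤s) 0≤2) 0≤v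
    -- Over the denominator (s + 2)², which enters as the factor `v * v`, the numerators of t² and
    -- of 2 share `common` and a summand 4; they differ only in 2 s² against 4.
    common = 2# * (s * s) + 2# * (2# * 2#) * s
    tt≡ : t * t ≡ (common + (2# * (s * s) + 2# * 2#)) * (v * v)
    tt≡ = solve 2 (λ s v →
        (con 2 :* s :+ con 2) :* v :* ((con 2 :* s :+ con 2) :* v) :=
        (con 2 :* (s :* s) :+ con 2 :* (con 2 :* con 2) :* s :+ (con 2 :* (s :* s) :+ con 2 :* con 2)) :* (v :* v))
      refl s v
    2≡ : 2# ≡ (common + (2# * 2# + 2# * 2#)) * (v * v)
    2≡ = begin-equality
      2#                                         ≡⟨ *-identityʳ 2# ⟨
      2# * 1#                                    ≡⟨ cong (2# *_) (*-identityʳ 1#) ⟨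
      2# * (1# * 1#)                             ≡⟨ cong (λ u → 2# * (u * u)) [s+2]v≡1 ⟨
      2# * ((s + 2#) * v * ((s + 2#) * v))       ≡⟨ solve 2 (λ s v →
        con 2 :* ((s :+ con 2) :* v :* ((s :+ con 2) :* v)) :=
        (con 2 :* (s :* s) :+ con 2 :* (con 2 :* con 2) :* s :+ (con 2 :* con 2 :+ con 2 :* con 2)) :* (v :* v))
        refl s v ⟩
      (common + (2# * 2# + 2# * 2#)) * (v * v)   ∎
    0≤vv : 0# ≤ v * v
    0≤vv = *-nonNegative 0≤v 0≤v
    ss≤2⇒tt≤2 : s * s ≤ 2# → t * t ≤ 2#
    ss≤2⇒tt≤2 ss≤2 = subst₂ _≤_ (sym tt≡) (sym 2≡)
      (*-monoʳ-≤ 0≤vv (+-monoʳ-≤ common (+-monoˡ-≤ (2# * 2#) (*-monoˡ-≤ 0≤2 ss≤2))))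
    2≤ss⇒2≤tt : 2# ≤ s * s → 2# ≤ t * t
    2≤ss⇒2≤tt 2≤ss = subst₂ _≤_ (sym 2≡) (sym tt≡)
      (*-monoʳ-≤ 0≤vv (+-monoʳ-≤ common (+-monoˡ-≤ (2# * 2#) (*-monoˡ-≤ 0≤2 2≤ss))))
    [s+2]t≡ : (s + 2#) * t ≡ 2# * s + 2#
    [s+2]t≡ = begin-equality
      (s + 2#) * ((2# * s + 2#) * v)  ≡⟨ solve 3 (λ a b v → a :* (b :* v) := b :* (a :* v)) refl (s + 2#) (2# * s + 2#) v ⟩
      (2# * s + 2#) * ((s + 2#) * v)  ≡⟨ cong ((2# * s + 2#) *_) [s+2]v≡1 ⟩
      (2# * s + 2#) * 1#              ≡⟨ *-identityʳ _ ⟩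
      2# * s + 2#                     ∎
    [s+2]s≡ : (s + 2#) * s ≡ 2# * s + s * s
    [s+2]s≡ = solve 1 (λ s → (s :+ con 2) :* s := con 2 :* s :+ s :* s) refl s
    t≤s⇒2≤ss : t ≤ s → 2# ≤ s * s
    t≤s⇒2≤ss t≤s = +-cancelˡ-≤ (2# * s) (subst₂ _≤_ [s+2]t≡ [s+2]s≡ (*-monoˡ-≤ 0≤s+2 t≤s))
    s≤t⇒ss≤2 : s ≤ t → s * s ≤ 2#
    s≤t⇒ss≤2 s≤t = +-cancelˡ-≤ (2# * s) (subst₂ _≤_ [s+2]s≡ [s+2]t≡ (*-monoˡ-≤ 0≤s+2 s≤t))
    ss≡2 : s * s ≡ 2#
    ss≡2 with total (s * s) 2#
    ... | inj₁ ss≤2 = antisym ss≤2 (t≤s⇒2≤ss (upper t (ss≤2⇒tt≤2 ss≤2)))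
    ... | inj₂ 2≤ss = antisym (s≤t⇒ss≤2 (least t λ x xx≤2 →
      square-cancel-≤ 0≤t (≤-trans xx≤2 (2≤ss⇒2≤tt 2≤ss)))) 2≤ss

-- The constants δ and κ and their identities.

module SilverRatio (reals : RealNumbers) where
  open RealNumbers reals
  open OrderedField reals

  -- Sealed, so that √2 is an atom of which only the sign and the square are known.
  abstract
    √2 : ℝ
    √2 = proj₁ √2-exists

    0≤√2 : 0# ≤ √2
    0≤√2 = proj₁ (proj₂ √2-exists)

    √2*√2≡2 : √2 * √2 ≡ 2#
    √2*√2≡2 = proj₂ (proj₂ √2-exists)

  δ κ : ℝ
  δ = √2 - 1#
  κ = 2# - √2

  1+δ≡√2 : 1# + δ ≡ √2
  1+δ≡√2 = x+[y-x]≡y 1# √2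

  δ+κ≡1 : δ + κ ≡ 1#
  δ+κ≡1 = +-cancelˡ 1# _ _ (begin-equality
    1# + (δ + κ)  ≡⟨ +-assoc 1# δ κ ⟨
    1# + δ + κ    ≡⟨ cong (_+ κ) 1+δ≡√2 ⟩
    √2 + κ        ≡⟨ x+[y-x]≡y √2 2# ⟩
    1# + 1#       ∎)

  -- With 1 + δ added on both sides and δ + κ = 1 this becomes (1 + δ)² = 2.
  [1+δ]δ≡κ : (1# + δ) * δ ≡ κ
  [1+δ]δ≡κ = +-cancelˡ δ _ _ (+-cancelˡ 1# _ _ (begin-equality
    1# + (δ + (1# + δ) * δ)  ≡⟨ solve 1 (λ δ → con 1 :+ (δ :+ (con 1 :+ δ) :* δ) := (con 1 :+ δ) :* (con 1 :+ δ)) refl δ ⟩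
    (1# + δ) * (1# + δ)      ≡⟨ cong (λ q → q * q) 1+δ≡√2 ⟩
    √2 * √2                  ≡⟨ √2*√2≡2 ⟩
    1# + 1#                  ≡⟨ cong (1# +_) δ+κ≡1 ⟨
    1# + (δ + κ)             ∎))

  [2+δ]δ≡1 : (2# + δ) * δ ≡ 1#
  [2+δ]δ≡1 = begin-equality
    (2# + δ) * δ        ≡⟨ solve 1 (λ δ → (con 2 :+ δ) :* δ := δ :+ (con 1 :+ δ) :* δ) refl δ ⟩
    δ + (1# + δ) * δ    ≡⟨ cong (δ +_) [1+δ]δ≡κ ⟩
    δ + κ               ≡⟨ δ+κ≡1 ⟩
    1#                  ∎

  0≤δ : 0# ≤ δ
  0≤δ = x≤y⇒0≤y-x (square-cancel-≤ 0≤√2 (subst₂ _≤_ (sym (*-identityˡ 1#)) (sym √2*√2≡2) (x≤x+y 0≤1)))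

  δ≤κ : δ ≤ κ
  δ≤κ = subst₂ _≤_ (*-identityˡ δ) [1+δ]δ≡κ (*-monoʳ-≤ 0≤δ (x≤x+y 0≤δ))

  0≤κ : 0# ≤ κ
  0≤κ = ≤-trans 0≤δ δ≤κ

-- Matchings and weak duality

mate? : ∀ {l r} (M : Mates l r) i j → Dec (lookup M i ≡ just j)
mate? M i j = ≡-dec Fin._≟_ (lookup M i) (just j)

MateInjective : ∀ {l r} → Mates l r → Set
MateInjective M = ∀ {i i′ j} → lookup M i ≡ just j → lookup M i′ ≡ just j → i ≡ i′

-- Lets the explicit optimal matchings of the adversary be verified by evaluation.
isMatching? : ∀ {l r} (G : BipartiteGraph l r) (M : Mates l r) → Dec (IsMatching G M)
isMatching? G M = map′
  (λ { (edge , injective) → record { edge = edge _ _ ; injective = injective _ _ _ } })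
  (λ m → (λ _ _ → IsMatching.edge m) , (λ _ _ _ → IsMatching.injective m))
  ((Fin.all? λ i → Fin.all? λ j → mate? M i j →-dec (i ∈? N j)) ×-dec
   (Fin.all? λ i → Fin.all? λ k → Fin.all? λ j → mate? M i j →-dec (mate? M k j →-dec (i Fin.≟ k))))
  where open BipartiteGraph G

module FiniteSums (reals : RealNumbers) where
  open RealNumbers reals
  open OrderedField reals
  open import Algebra.Properties.Semiring.Sum semiring public
    using (sum-cong-≗; sum-replicate-zero; ∑-distrib-+; ∑-comm; *-distribˡ-sum)

  sum-zero : ∀ {n} {f : Fin n → ℝ} → (∀ i → f i ≡ 0#) → sum f ≡ 0#
  sum-zero {n} f≡0 = trans (sum-cong-≗ f≡0) (sum-replicate-zero n)

  sum-mono-≤ : ∀ {n} {f g : Fin n → ℝ} → (∀ i → f i ≤ g i) → sum f ≤ sum g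
  sum-mono-≤ {ℕ.zero}  f≤g = ≤-refl
  sum-mono-≤ {ℕ.suc n} f≤g = +-mono-≤ (f≤g zero) (sum-mono-≤ (f≤g ∘ suc))

  sum-nonNegative : ∀ {n} {f : Fin n → ℝ} → (∀ i → 0# ≤ f i) → 0# ≤ sum f
  sum-nonNegative {n} {f} 0≤f = subst (_≤ sum f) (sum-replicate-zero n) (sum-mono-≤ 0≤f)

  term≤sum : ∀ {n} {f : Fin n → ℝ} → (∀ i → 0# ≤ f i) → ∀ i → f i ≤ sum f
  term≤sum 0≤f zero    = x≤x+y (sum-nonNegative (0≤f ∘ suc))
  term≤sum 0≤f (suc i) = ≤-trans (term≤sum (0≤f ∘ suc) i) (x≤y+x (0≤f zero))

  sum-increase : ∀ {n} {f g : Fin n → ℝ} {a} i → g i ≡ f i + a → (∀ k → k ≢ i → g k ≡ f k) →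
                 sum g ≡ sum f + a
  sum-increase {f = f} {g} {a} zero gi≡ g≡f = begin-equality
    g zero + sum (g ∘ suc)        ≡⟨ cong (g zero +_) (sum-cong-≗ λ k → g≡f (suc k) λ ()) ⟩
    g zero + sum (f ∘ suc)        ≡⟨ cong (_+ sum (f ∘ suc)) gi≡ ⟩
    f zero + a + sum (f ∘ suc)    ≡⟨ solve 3 (λ x a s → x :+ a :+ s := x :+ s :+ a) refl (f zero) a (sum (f ∘ suc)) ⟩
    f zero + sum (f ∘ suc) + a    ∎
  sum-increase {f = f} {g} {a} (suc i) gi≡ g≡f = begin-equality
    g zero + sum (g ∘ suc)        ≡⟨ cong (_+ sum (g ∘ suc)) (g≡f zero λ ()) ⟩
    f zero + sum (g ∘ suc)        ≡⟨ cong (f zero +_) (sum-increase i gi≡ λ k k≢i → g≡f (suc k) (k≢i ∘ Fin.suc-injective)) ⟩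
    f zero + (sum (f ∘ suc) + a)  ≡⟨ +-assoc (f zero) (sum (f ∘ suc)) a ⟨
    f zero + sum (f ∘ suc) + a    ∎

  -- The form in which "at most one mate", for a vertex of either side, enters estimates of double
  -- sums.
  sum-unique-≤ : ∀ {n} {P : Fin n → Set} (P? : ∀ i → Dec (P i)) {b} → 0# ≤ b →
                 (∀ {i k} → P i → P k → i ≡ k) → sum (λ i → if does (P? i) then b else 0#) ≤ b
  sum-unique-≤ {ℕ.zero} P? 0≤b unique = 0≤b
  sum-unique-≤ {ℕ.suc n} P? {b} 0≤b unique with P? zero
  ... | yes p = ≤-reflexive (trans (cong (b +_) (sum-zero none)) (+-identityʳ b))
    where
    none : ∀ i → (if does (P? (suc i)) then b else 0#) ≡ 0#
    none i with P? (suc i)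
    ... | yes q = contradiction (unique p q) λ ()
    ... | no _  = refl
  ... | no _  = subst (_≤ b) (sym (+-identityˡ _))
    (sum-unique-≤ (P? ∘ suc) 0≤b λ p q → Fin.suc-injective (unique p q))

  if-nonNegative : ∀ b {x} → 0# ≤ x → 0# ≤ (if b then x else 0#)
  if-nonNegative true  0≤x = 0≤x
  if-nonNegative false _   = ≤-refl

  -- For `v = lookup w` this unfolds to the weight of a matching in an instance; a general `v` also
  -- admits the scaled weights (1 + δ) w.
  coveredSum : ∀ {l r} → (Fin l → ℝ) → Mates l r → ℝ
  coveredSum v M = sum (λ i → if is-just (lookup M i) then v i else 0#)

  -- Each matched i is paid for by its own price and that of its mate. Summed over i, the price of j
  -- occurs at most once, since j has at most one mate.
  weak-duality : ∀ {l r} (M : Mates l r) → MateInjective M →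
                 {v y : Fin l → ℝ} {z : Fin r → ℝ} → (∀ i → 0# ≤ y i) → (∀ j → 0# ≤ z j) →
                 (∀ {i j} → lookup M i ≡ just j → v i ≤ y i + z j) →
                 coveredSum v M ≤ sum y + sum z
  weak-duality M injective {v} {y} {z} 0≤y 0≤z covered = begin
    coveredSum v M                           ≤⟨ sum-mono-≤ (λ i → pointwise i (lookup M i) refl) ⟩
    sum (λ i → y i + sum (λ j → share i j))  ≡⟨ ∑-distrib-+ y _ ⟩
    sum y + sum (λ i → sum (share i))        ≡⟨ cong (sum y +_) (∑-comm share) ⟩
    sum y + sum (λ j → sum λ i → share i j)  ≤⟨ +-monoʳ-≤ _ (sum-mono-≤ λ j → sum-unique-≤ (λ i → mate? M i j) (0≤z j) injective) ⟩
    sum y + sum z                            ∎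
    where
    share : ∀ i j → ℝ
    share i j = if does (mate? M i j) then z j else 0#
    0≤share : ∀ i j → 0# ≤ share i j
    0≤share i j = if-nonNegative (does (mate? M i j)) (0≤z j)
    own-share : ∀ {i j} → lookup M i ≡ just j → z j ≤ share i j
    own-share {i} {j} Mi≡j with mate? M i j
    ... | yes _    = ≤-refl
    ... | no Mi≢j = contradiction Mi≡j Mi≢j
    pointwise : ∀ i m → lookup M i ≡ m → (if is-just m then v i else 0#) ≤ y i + sum (share i)
    pointwise i nothing  _    = +-nonNegative (0≤y i) (sum-nonNegative (0≤share i))
    pointwise i (just j) Mi≡j = ≤-trans (covered Mi≡j) (+-monoʳ-≤ (y i)
                                  (≤-trans (own-share Mi≡j) (term≤sum (0≤share i) j)))

  *-distribˡ-coveredSum : ∀ {l r} q (v : Fin l → ℝ) (M : Mates l r) →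
                          q * coveredSum v M ≡ coveredSum (λ i → q * v i) M
  *-distribˡ-coveredSum q v M =
    trans (*-distribˡ-sum q (λ i → if is-just (lookup M i) then v i else 0#))
          (sum-cong-≗ λ i → distrib (is-just (lookup M i)) (v i))
    where
    distrib : ∀ b x → q * (if b then x else 0#) ≡ (if b then q * x else 0#)
    distrib true  x = refl
    distrib false x = zeroʳ q

  coveredSum-empty : ∀ {l r} (v : Fin l → ℝ) → coveredSum {l} {r} v (replicate l nothing) ≡ 0#
  coveredSum-empty {l} {r} v = sum-zero λ i →
    cong (λ m → if is-just m then v i else 0#) (lookup-replicate i (nothing {A = Fin r}))

  coveredSum-match : ∀ {l r} (v : Fin l → ℝ) (M : Mates l r) {i j} → lookup M i ≡ nothing →
                     coveredSum v (M [ i ]≔ just j) ≡ coveredSum v M + v i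
  coveredSum-match v M {i} {j} Mi≡nothing = sum-increase i at-i elsewhere
    where
    at-i : (if is-just (lookup (M [ i ]≔ just j) i) then v i else 0#) ≡
           (if is-just (lookup M i) then v i else 0#) + v i
    at-i rewrite lookup∘update i M (just j) | Mi≡nothing = sym (+-identityˡ (v i))
    elsewhere : ∀ k → k ≢ i → _
    elsewhere k k≢i = cong (λ m → if is-just m then v k else 0#) (lookup∘update′ k≢i M (just j))

  coveredSum-rematch : ∀ {l r} (v : Fin l → ℝ) (M : Mates l r) {i j j′} → lookup M i ≡ just j →
                       coveredSum v (M [ i ]≔ just j′) ≡ coveredSum v M
  coveredSum-rematch v M {i} {j} {j′} Mi≡j =
    sum-cong-≗ λ k → cong (if_then v k else 0#) (same k)
    where
    same : ∀ k → is-just (lookup (M [ i ]≔ just j′) k) ≡ is-just (lookup M k)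
    same k with k Fin.≟ i
    ... | yes refl = trans (cong is-just (lookup∘update i M (just j′))) (sym (cong is-just Mi≡j))
    ... | no k≢i   = cong is-just (lookup∘update′ k≢i M (just j′))

-- The greedy policy

data Status (l : ℕ) : Set where
  free frozen : Status l
  -- A matched vertex whose mate has this neighbourhood, neither of them
  -- reassigned so far.
  live : Subset l → Status l

Profile : ℕ → Set
Profile l = Vec (Status l) l

free? : ∀ {l} (s : Status l) → Dec (s ≡ free)
free? free     = yes refl
free? frozen   = no λ ()
free? (live S) = no λ ()

module _ {l : ℕ} (A : Profile l) where

  Direct : Subset l → Fin l → Set
  Direct S i = i ∈ S × lookup A i ≡ free

  -- The mate y of x enters only through its neighbourhood `T`, the one trace of y visible to a
  -- policy.
  Reroute : Subset l → Fin l × Fin l → Set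
  Reroute S (x , i) = x ∈ S × ∃[ T ] lookup A x ≡ live T × Direct T i

  direct? : ∀ S i → Dec (Direct S i)
  direct? S i = (i ∈? S) ×-dec free? (lookup A i)

  via? : ∀ i s → Dec (∃[ T ] s ≡ live T × Direct T i)
  via? i free   = no λ { (_ , () , _) }
  via? i frozen = no λ { (_ , () , _) }
  via? i (live T) with direct? T i
  ... | yes d = yes (T , refl , d)
  ... | no ¬d = no λ { (_ , refl , d) → ¬d d }

  reroute? : ∀ S xi → Dec (Reroute S xi)
  reroute? S (x , i) = (x ∈? S) ×-dec via? i (lookup A x)

-- After a rerouting, each of the two pairs contains a vertex that has spent its only reassignment:
-- x in one, its former mate in the other. Neither pair can be rerouted again, so both become
-- `frozen`.
update : ∀ {l} → Profile l → Subset l → Decision l → Profile l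
update A S leave          = A
update A S (augment₁ i)   = A [ i ]≔ live S
update A S (augment₃ x i) = (A [ x ]≔ frozen) [ i ]≔ frozen

module Greedy (reals : RealNumbers) where
  open RealNumbers reals
  open OrderedField reals
  open SilverRatio reals

  argmax : ∀ {C : Set} {P : C → Set} (P? : ∀ c → Dec (P c)) (score : C → ℝ) (cs : List C) →
           (∃[ c ] P c × ∀ {k} → k List.∈ cs → P k → score k ≤ score c) ⊎
           (∀ {k} → k List.∈ cs → ¬ P k)
  argmax P? score [] = inj₂ λ ()
  argmax P? score (c ∷ cs) with P? c | argmax P? score cs
  ... | no ¬p | inj₂ none = inj₂ λ { (here refl) → ¬p ; (there k∈) → none k∈ }
  ... | no ¬p | inj₁ (d , q , max) =
    inj₁ (d , q , λ { (here refl) p → contradiction p ¬p ; (there k∈) → max k∈ })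
  ... | yes p | inj₂ none =
    inj₁ (c , p , λ { (here refl) _ → ≤-refl ; (there k∈) r → contradiction r (none k∈) })
  ... | yes p | inj₁ (d , q , max) with total (score c) (score d)
  ...   | inj₁ c≤d = inj₁ (d , q , λ { (here refl) _ → c≤d ; (there k∈) → max k∈ })
  ...   | inj₂ d≤c = inj₁ (c , p , λ { (here refl) _ → ≤-refl ; (there k∈) r → ≤-trans (max k∈ r) d≤c })

  bestDirect : ∀ {l} (w : Vec ℝ l) (A : Profile l) S →
               (∃[ a ] Direct A S a × ∀ {i} → Direct A S i → lookup w i ≤ lookup w a) ⊎
               (∀ {i} → ¬ Direct A S i)
  bestDirect {l} w A S with argmax (direct? A S) (lookup w) (allFin l)
  ... | inj₁ (a , d , max) = inj₁ (a , d , λ {i} → max (∈-allFin i))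
  ... | inj₂ none          = inj₂ λ {i} → none (∈-allFin i)

  bestReroute : ∀ {l} (w : Vec ℝ l) (A : Profile l) S →
                (∃[ x ] ∃[ b ] Reroute A S (x , b) ×
                  ∀ {y i} → Reroute A S (y , i) → lookup w i ≤ lookup w b) ⊎
                (∀ {y i} → ¬ Reroute A S (y , i))
  bestReroute {l} w A S with argmax (reroute? A S) (lookup w ∘ proj₂) (cartesianProduct (allFin l) (allFin l))
  ... | inj₁ ((x , b) , d , max) =
    inj₁ (x , b , d , λ {y} {i} → max (∈-cartesianProduct⁺ (∈-allFin y) (∈-allFin i)))
  ... | inj₂ none = inj₂ λ {y} {i} → none (∈-cartesianProduct⁺ (∈-allFin y) (∈-allFin i))

  -- The optimality facts that the charging argument draws from a decision. The threshold δ appears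
  -- twice: a direct match is worth at least δ times every reachable end, and a rerouting is made
  -- only if no free neighbour exceeds δ times its end. Without an option of the other kind the
  -- comparison is vacuous.
  data Choice {l} (w : Vec ℝ l) (A : Profile l) (S : Subset l) : Decision l → Set where
    leave    : (∀ {i} → ¬ Direct A S i) → (∀ {x i} → ¬ Reroute A S (x , i)) → Choice w A S leave
    augment₁ : ∀ {a} → Direct A S a →
               (∀ {i} → Direct A S i → lookup w i ≤ lookup w a) →
               (∀ {x i} → Reroute A S (x , i) → δ * lookup w i ≤ lookup w a) →
               Choice w A S (augment₁ a)
    augment₃ : ∀ {x b} → Reroute A S (x , b) →
               (∀ {i} → Direct A S i → lookup w i ≤ δ * lookup w b) →
               (∀ {y i} → Reroute A S (y , i) → lookup w i ≤ lookup w b) →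
               Choice w A S (augment₃ x b)

  choose : ∀ {l} (w : Vec ℝ l) (A : Profile l) (S : Subset l) → ∃[ d ] Choice w A S d
  choose w A S with bestDirect w A S | bestReroute w A S
  ... | inj₂ none₁ | inj₂ none₃ = leave , leave none₁ none₃
  ... | inj₁ (a , d , max) | inj₂ none₃ = augment₁ a , augment₁ d max λ r → contradiction r none₃
  ... | inj₂ none₁ | inj₁ (x , b , r , max) =
    augment₃ x b , augment₃ r (λ d → contradiction d none₁) max
  ... | inj₁ (a , d , max₁) | inj₁ (x , b , r , max₃) with total (δ * lookup w b) (lookup w a)
  ...   | inj₁ δb≤a = augment₁ a , augment₁ d max₁ λ r → ≤-trans (*-monoˡ-≤ 0≤δ (max₃ r)) δb≤a
  ...   | inj₂ a≤δb = augment₃ x b , augment₃ r (λ d → ≤-trans (max₁ d) a≤δb) max₃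

  -- A policy receives no record of its earlier decisions, so the profile is recomputed by replaying
  -- them. The latest arrival heads the list, hence the tail yields the profile that it met.
  simulate : ∀ {l} → Vec ℝ l → List (Subset l) → Profile l
  simulate {l} w []   = replicate l free
  simulate w (S ∷ past) = update A S (proj₁ (choose w A S))
    where A = simulate w past

  decide : WOMP₃.Policy reals 1 1
  decide w past S = proj₁ (choose w (simulate w past) S)

-- The charging invariant

lookup-≔⁻ : ∀ {X : Set} {n} (v : Vec X n) {i k a b} → lookup (v [ i ]≔ a) k ≡ b →
            (k ≡ i × b ≡ a) ⊎ (k ≢ i × lookup v k ≡ b)
lookup-≔⁻ v {i} {k} {a} vk≡ with k Fin.≟ i
... | yes refl = inj₁ (refl , trans (sym vk≡) (lookup∘update i v a))
... | no k≢i   = inj₂ (k≢i , trans (sym (lookup∘update′ k≢i v a)) vk≡)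

lookup-≔-other⁻ : ∀ {X : Set} {n} (v : Vec X n) {i k a b} → b ≢ a → lookup (v [ i ]≔ a) k ≡ b →
                  k ≢ i × lookup v k ≡ b
lookup-≔-other⁻ v b≢a vk≡ with lookup-≔⁻ v vk≡
... | inj₁ (_ , b≡a) = contradiction b≡a b≢a
... | inj₂ other     = other

arrived-cases : ∀ {r} {j : Fin r} {js} k → ¬ k List.∈ js → k ≡ j ⊎ ¬ k List.∈ (j ∷ js)
arrived-cases {j = j} k k∉ with k Fin.≟ j
... | yes k≡j = inj₁ k≡j
... | no k≢j  = inj₂ λ { (here k≡j) → k≢j k≡j ; (there k∈) → k∉ k∈ }

module Charging (reals : RealNumbers) {l r : ℕ} (G : BipartiteGraph l r)
                (w : Vec (RealNumbers.ℝ reals) l) where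
  open RealNumbers reals
  open OrderedField reals
  open SilverRatio reals
  open FiniteSums reals
  open Greedy reals
  open BipartiteGraph G

  weight : Mates l r → ℝ
  weight = coveredSum (lookup w)

  -- The charges Z split the weight gained so far among the arrived vertices of
  -- R; js lists those still to arrive.
  record Invariant (js : List (Fin r)) (A : Profile l) (σ : State l r) (Z : Fin r → ℝ) : Set where
    open State σ
    field
      free⇒   : ∀ {i} → lookup A i ≡ free → lookup M i ≡ nothing × lookup reassignedL i ≡ 0
      frozen⇒ : ∀ {i} → lookup A i ≡ frozen → ∃[ j ] lookup M i ≡ just j
      live⇒   : ∀ {i S} → lookup A i ≡ live S → ∃[ j ] lookup M i ≡ just j × N j ≡ S ×
                lookup reassignedL i ≡ 0 × lookup reassignedR j ≡ 0
      mate-arrived   : ∀ {i j} → lookup M i ≡ just j → ¬ j List.∈ js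
      mate-injective : MateInjective M
      fresh          : ∀ {j} → j List.∈ js → lookup reassignedR j ≡ 0
      Z-nonNegative  : ∀ j → 0# ≤ Z j
      -- An arrived j must finally afford (1 + δ) w(i) for each free neighbour i. Either its charge
      -- already does, or j sits in a live pair and holds only w(i); the missing δ w(i) then comes
      -- from a later rerouting of that pair or from the final transfer.
      direct-bound   : ∀ {j i} → ¬ j List.∈ js → Direct A (N j) i →
                       (1# + δ) * lookup w i ≤ Z j ⊎
                       (∃[ a ] ∃[ S ] lookup A a ≡ live S × lookup M a ≡ just j × lookup w i ≤ Z j)
      -- Allows a live vertex x to pass δ w(i) on to its mate: any other neighbour j of x makes up
      -- for the lowered price of x.
      reroute-bound  : ∀ {j x i} → ¬ j List.∈ js → Reroute A (N j) (x , i) → δ * lookup w i ≤ Z j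
      -- Ensures that a live vertex can afford its final transfer.
      live-bound     : ∀ {a S i} → lookup A a ≡ live S → Direct A S i → lookup w i ≤ lookup w a
      total-charge   : sum Z ≡ weight M

  -- No vertex of R has arrived and no vertex of L is matched, so the bounds are vacuous.
  initial-invariant : ∀ {js} → (∀ j → j List.∈ js) →
                      Invariant js (replicate l free) initial (λ _ → 0#)
  initial-invariant all∈ = record
    { free⇒          = λ {i} _ → lookup-replicate i nothing , lookup-replicate i 0
    ; frozen⇒        = λ {i} Ai≡ → contradiction (trans (sym (lookup-replicate i free)) Ai≡) λ ()
    ; live⇒          = λ {i} Ai≡ → contradiction (trans (sym (lookup-replicate i free)) Ai≡) λ ()
    ; mate-arrived   = λ {i} Mi≡ → contradiction (trans (sym (lookup-replicate i nothing)) Mi≡) λ ()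
    ; mate-injective = λ {i} Mi≡ → contradiction (trans (sym (lookup-replicate i nothing)) Mi≡) λ ()
    ; fresh          = λ {j} _ → lookup-replicate j 0
    ; Z-nonNegative  = λ _ → ≤-refl
    ; direct-bound   = λ {j} j∉ → contradiction (all∈ j) j∉
    ; reroute-bound  = λ {j} j∉ → contradiction (all∈ j) j∉
    ; live-bound     = λ {a} Aa≡ → contradiction (trans (sym (lookup-replicate a free)) Aa≡) λ ()
    ; total-charge   = trans (sum-zero {r} λ _ → refl) (sym (coveredSum-empty {l} {r} (lookup w)))
    }

  charge : Fin r → ℝ → (Fin r → ℝ) → Fin r → ℝ
  charge j a Z k = if does (k Fin.≟ j) then Z k + a else Z k

  charge-at : ∀ j a Z → charge j a Z j ≡ Z j + a
  charge-at j a Z with j Fin.≟ j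
  ... | yes _  = refl
  ... | no j≢j = contradiction refl j≢j

  charge-elsewhere : ∀ j a Z k → k ≢ j → charge j a Z k ≡ Z k
  charge-elsewhere j a Z k k≢j with k Fin.≟ j
  ... | yes k≡j = contradiction k≡j k≢j
  ... | no _    = refl

  charge-≥ : ∀ {j a} Z → 0# ≤ a → ∀ k → Z k ≤ charge j a Z k
  charge-≥ {j} Z 0≤a k with k Fin.≟ j
  ... | yes _ = x≤x+y 0≤a
  ... | no _  = ≤-refl

  charge-at-≥ : ∀ {j a} Z → 0# ≤ Z j → a ≤ charge j a Z j
  charge-at-≥ {j} {a} Z 0≤Zj = subst (a ≤_) (sym (charge-at j a Z)) (x≤y+x 0≤Zj)

  sum-charge : ∀ j a Z → sum (charge j a Z) ≡ sum Z + a
  sum-charge j a Z = sum-increase j (charge-at j a Z) (charge-elsewhere j a Z)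

  -- Preservation of the invariant by the three decisions.

  module _ (0≤w : ∀ i → 0# ≤ lookup w i) where

    δw≤w : ∀ i → δ * lookup w i ≤ lookup w i
    δw≤w i = subst (δ * lookup w i ≤_) (*-identityˡ (lookup w i))
      (*-monoʳ-≤ (0≤w i) (subst (δ ≤_) δ+κ≡1 (x≤x+y 0≤κ)))

    w≤[1+δ]w : ∀ i → lookup w i ≤ (1# + δ) * lookup w i
    w≤[1+δ]w i = subst (_≤ (1# + δ) * lookup w i) (*-identityˡ (lookup w i))
      (*-monoʳ-≤ (0≤w i) (x≤x+y 0≤δ))

    [1+δ]w≡w+δw : ∀ i → (1# + δ) * lookup w i ≡ lookup w i + δ * lookup w i
    [1+δ]w≡w+δw i = solve 2 (λ δ x → (con 1 :+ δ) :* x := x :+ δ :* x) refl δ (lookup w i)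

    -- The newly arrived j has neither a free neighbour nor a rerouting path, so it needs no charge.
    leave-invariant : ∀ {j js A σ Z} → Invariant (j ∷ js) A σ Z →
                      (∀ {i} → ¬ Direct A (N j) i) → (∀ {x i} → ¬ Reroute A (N j) (x , i)) →
                      Invariant js A σ Z
    leave-invariant {j} {js} {A} {σ} {Z} inv none₁ none₃ = record
      { free⇒ = free⇒ ; frozen⇒ = frozen⇒ ; live⇒ = live⇒
      ; mate-arrived = λ Mi≡ k∈ → mate-arrived Mi≡ (there k∈)
      ; mate-injective = mate-injective
      ; fresh = λ k∈ → fresh (there k∈)
      ; Z-nonNegative = Z-nonNegative
      ; direct-bound = direct-bound′
      ; reroute-bound = reroute-bound′
      ; live-bound = live-bound
      ; total-charge = total-charge
      }
      where
      open State σ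
      open Invariant inv
      direct-bound′ : ∀ {k i} → ¬ k List.∈ js → Direct A (N k) i →
                      (1# + δ) * lookup w i ≤ Z k ⊎
                      (∃[ a ] ∃[ S ] lookup A a ≡ live S × lookup M a ≡ just k × lookup w i ≤ Z k)
      direct-bound′ {k} k∉ d with arrived-cases {j = j} k k∉
      ... | inj₁ refl = contradiction d none₁
      ... | inj₂ k∉′  = direct-bound k∉′ d
      reroute-bound′ : ∀ {k x i} → ¬ k List.∈ js → Reroute A (N k) (x , i) → δ * lookup w i ≤ Z k
      reroute-bound′ {k} k∉ d with arrived-cases {j = j} k k∉
      ... | inj₁ refl = contradiction d none₃
      ... | inj₂ k∉′  = reroute-bound k∉′ d

    -- The charge w(a) settles all bounds of j, with (a , j) as the live pair in the second
    -- alternative of `direct-bound`. The delicate point is that a, once live, opens rerouting paths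
    -- for earlier vertices.
    augment₁-invariant :
      ∀ {j js A M cL cR Z a} → ¬ j List.∈ js → Invariant (j ∷ js) A (state M cL cR) Z →
      Direct A (N j) a →
      (∀ {i} → Direct A (N j) i → lookup w i ≤ lookup w a) →
      (∀ {x i} → Reroute A (N j) (x , i) → δ * lookup w i ≤ lookup w a) →
      Invariant js (update A (N j) (augment₁ a)) (state (M [ a ]≔ just j) cL cR)
        (charge j (lookup w a) Z)
    augment₁-invariant {j} {js} {A} {M} {cL} {cR} {Z} {a} j∉js inv (a∈N , Aa≡free) max₁ max₃ = record
      { free⇒ = free⇒′ ; frozen⇒ = frozen⇒′ ; live⇒ = live⇒′
      ; mate-arrived = mate-arrived′
      ; mate-injective = mate-injective′
      ; fresh = λ k∈ → fresh (there k∈)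
      ; Z-nonNegative = λ k → ≤-trans (Z-nonNegative k) (Z≤Z′ k)
      ; direct-bound = direct-bound′
      ; reroute-bound = reroute-bound′
      ; live-bound = live-bound′
      ; total-charge = begin-equality
          sum Z′                  ≡⟨ sum-charge j (lookup w a) Z ⟩
          sum Z + lookup w a      ≡⟨ cong (_+ lookup w a) total-charge ⟩
          weight M + lookup w a   ≡⟨ coveredSum-match (lookup w) M (proj₁ (free⇒ Aa≡free)) ⟨
          weight M′               ∎
      }
      where
      open Invariant inv
      A′ = update A (N j) (augment₁ a)
      M′ = M [ a ]≔ just j
      Z′ = charge j (lookup w a) Z
      Z≤Z′ : ∀ k → Z k ≤ Z′ k
      Z≤Z′ = charge-≥ Z (0≤w a)
      wa≤Z′j : lookup w a ≤ Z′ j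
      wa≤Z′j = charge-at-≥ Z (Z-nonNegative j)
      unchanged : ∀ {i} → i ≢ a → lookup M′ i ≡ lookup M i
      unchanged i≢a = lookup∘update′ i≢a M (just j)
      direct⁻ : ∀ {S i} → Direct A′ S i → Direct A S i
      direct⁻ (i∈S , A′i≡) = i∈S , proj₂ (lookup-≔-other⁻ A (λ ()) A′i≡)
      free⇒′ : ∀ {i} → lookup A′ i ≡ free → lookup M′ i ≡ nothing × lookup cL i ≡ 0
      free⇒′ A′i≡ with i≢a , Ai≡ ← lookup-≔-other⁻ A (λ ()) A′i≡ =
        trans (unchanged i≢a) (proj₁ (free⇒ Ai≡)) , proj₂ (free⇒ Ai≡)
      frozen⇒′ : ∀ {i} → lookup A′ i ≡ frozen → ∃[ k ] lookup M′ i ≡ just k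
      frozen⇒′ A′i≡ with i≢a , Ai≡ ← lookup-≔-other⁻ A (λ ()) A′i≡ with k , Mi≡ ← frozen⇒ Ai≡ =
        k , trans (unchanged i≢a) Mi≡
      live⇒′ : ∀ {i S} → lookup A′ i ≡ live S →
               ∃[ k ] lookup M′ i ≡ just k × N k ≡ S × lookup cL i ≡ 0 × lookup cR k ≡ 0
      live⇒′ A′i≡ with lookup-≔⁻ A A′i≡
      ... | inj₁ (refl , refl) =
        j , lookup∘update a M (just j) , refl , proj₂ (free⇒ Aa≡free) , fresh (here refl)
      ... | inj₂ (i≢a , Ai≡) with k , Mi≡ , rest ← live⇒ Ai≡ = k , trans (unchanged i≢a) Mi≡ , rest
      mate-arrived′ : ∀ {i k} → lookup M′ i ≡ just k → ¬ k List.∈ js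
      mate-arrived′ M′i≡ with lookup-≔⁻ M M′i≡
      ... | inj₁ (_ , refl) = j∉js
      ... | inj₂ (_ , Mi≡)  = λ k∈ → mate-arrived Mi≡ (there k∈)
      mate-injective′ : MateInjective M′
      mate-injective′ M′i≡ M′i′≡ with lookup-≔⁻ M M′i≡ | lookup-≔⁻ M M′i′≡
      ... | inj₁ (refl , _)    | inj₁ (refl , _)    = refl
      ... | inj₁ (_ , refl)    | inj₂ (_ , Mi′≡)    = contradiction (here refl) (mate-arrived Mi′≡)
      ... | inj₂ (_ , Mi≡)     | inj₁ (_ , refl)    = contradiction (here refl) (mate-arrived Mi≡)
      ... | inj₂ (_ , Mi≡)     | inj₂ (_ , Mi′≡)    = mate-injective Mi≡ Mi′≡
      direct-bound′ : ∀ {k i} → ¬ k List.∈ js → Direct A′ (N k) i →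
                      (1# + δ) * lookup w i ≤ Z′ k ⊎
                      (∃[ b ] ∃[ S ] lookup A′ b ≡ live S × lookup M′ b ≡ just k × lookup w i ≤ Z′ k)
      direct-bound′ {k} k∉ d with arrived-cases {j = j} k k∉
      ... | inj₁ refl = inj₂ (a , N j , lookup∘update a A (live (N j)) , lookup∘update a M (just j) ,
                              ≤-trans (max₁ (direct⁻ d)) wa≤Z′j)
      ... | inj₂ k∉′ with direct-bound k∉′ (direct⁻ d)
      ...   | inj₁ bound = inj₁ (≤-trans bound (Z≤Z′ k))
      ...   | inj₂ (b , S , Ab≡ , Mb≡ , bound) =
        inj₂ (b , S , trans (lookup∘update′ b≢a A (live (N j))) Ab≡ , trans (unchanged b≢a) Mb≡ ,
              ≤-trans bound (Z≤Z′ k))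
        where
        b≢a : b ≢ a
        b≢a refl = contradiction (trans (sym Aa≡free) Ab≡) λ ()
      live-bound′ : ∀ {b S i} → lookup A′ b ≡ live S → Direct A′ S i → lookup w i ≤ lookup w b
      live-bound′ A′b≡ d with lookup-≔⁻ A A′b≡
      ... | inj₁ (refl , refl) = max₁ (direct⁻ d)
      ... | inj₂ (_ , Ab≡)     = live-bound Ab≡ (direct⁻ d)
      reroute-bound′ : ∀ {k x i} → ¬ k List.∈ js → Reroute A′ (N k) (x , i) → δ * lookup w i ≤ Z′ k
      reroute-bound′ {k} {x} {i} k∉ (x∈N , S , A′x≡ , d)
        with arrived-cases {j = j} k k∉ | lookup-≔⁻ A A′x≡
      -- Degenerate case: the mate of a is j itself, so i is merely a free neighbour of j.
      ... | inj₁ refl | inj₁ (refl , refl) =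
        ≤-trans (δw≤w i) (≤-trans (max₁ (direct⁻ d)) wa≤Z′j)
      ... | inj₁ refl | inj₂ (_ , Ax≡) = ≤-trans (max₃ (x∈N , S , Ax≡ , direct⁻ d)) wa≤Z′j
      ... | inj₂ k∉′ | inj₂ (_ , Ax≡) =
        ≤-trans (reroute-bound k∉′ (x∈N , S , Ax≡ , direct⁻ d)) (Z≤Z′ k)
      -- A new path from the earlier k through a. Since a was a free neighbour of k, either
      -- alternative of `direct-bound` gives w(a) ≤ Z k, and i is no heavier than a.
      ... | inj₂ k∉′ | inj₁ (refl , refl) =
        ≤-trans (δw≤w i) (≤-trans (max₁ (direct⁻ d)) (≤-trans wa≤Zk (Z≤Z′ k)))
        where
        wa≤Zk : lookup w a ≤ Z k
        wa≤Zk with direct-bound k∉′ (x∈N , Aa≡free)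
        ... | inj₁ bound                   = ≤-trans (w≤[1+δ]w a) bound
        ... | inj₂ (_ , _ , _ , _ , bound) = bound

    -- The gain w(b) splits as κ + δ = 1. Now j has no live pair and must afford (1 + δ) w(i) alone;
    -- as w(i) ≤ δ w(b), its share κ w(b) = (1 + δ) δ w(b) suffices. The share δ w(b) compensates y
    -- for the loss of its live pair.
    augment₃-invariant :
      ∀ {j js A M cL cR Z x y b} → ¬ j List.∈ js → Invariant (j ∷ js) A (state M cL cR) Z →
      x ∈ N j → lookup A x ≡ live (N y) → lookup M x ≡ just y → Direct A (N y) b →
      (∀ {i} → Direct A (N j) i → lookup w i ≤ δ * lookup w b) →
      (∀ {z i} → Reroute A (N j) (z , i) → lookup w i ≤ lookup w b) →
      Invariant js (update A (N j) (augment₃ x b))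
        (state ((M [ x ]≔ just j) [ b ]≔ just y) (cL [ x ]%= ℕ.suc) (cR [ y ]%= ℕ.suc))
        (charge j (κ * lookup w b) (charge y (δ * lookup w b) Z))
    augment₃-invariant {j} {js} {A} {M} {cL} {cR} {Z} {x} {y} {b}
      j∉js inv x∈Nj Ax≡live Mx≡y (_ , Ab≡free) max₁ max₃ = record
      { free⇒ = free⇒′ ; frozen⇒ = frozen⇒′ ; live⇒ = live⇒′
      ; mate-arrived = mate-arrived′
      ; mate-injective = mate-injective′
      ; fresh = λ k∈ → trans (lookup∘updateAt′ _ y (λ { refl → y∉js k∈ }) cR) (fresh (there k∈))
      ; Z-nonNegative = λ k → ≤-trans (Z-nonNegative k) (Z≤Z′ k)
      ; direct-bound = direct-bound′
      ; reroute-bound = reroute-bound′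
      ; live-bound = λ A′a≡ d → live-bound (proj₂ (proj₂ (unfrozen⁻ (λ ()) A′a≡))) (direct⁻ d)
      ; total-charge = begin-equality
          sum Z′                                            ≡⟨ sum-charge j _ _ ⟩
          sum (charge y (δ * lookup w b) Z) + κ * lookup w b ≡⟨ cong (_+ κ * lookup w b) (sum-charge y _ Z) ⟩
          sum Z + δ * lookup w b + κ * lookup w b           ≡⟨ solve 4 (λ s δ κ x → s :+ δ :* x :+ κ :* x := s :+ (δ :+ κ) :* x) refl (sum Z) δ κ (lookup w b) ⟩
          sum Z + (δ + κ) * lookup w b                      ≡⟨ cong (λ c → sum Z + c * lookup w b) δ+κ≡1 ⟩
          sum Z + 1# * lookup w b                           ≡⟨ cong (sum Z +_) (*-identityˡ (lookup w b)) ⟩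
          sum Z + lookup w b                                ≡⟨ cong (_+ lookup w b) total-charge ⟩
          weight M + lookup w b                             ≡⟨ cong (_+ lookup w b) (coveredSum-rematch (lookup w) M Mx≡y) ⟨
          weight (M [ x ]≔ just j) + lookup w b             ≡⟨ coveredSum-match (lookup w) (M [ x ]≔ just j) (trans (lookup∘update′ b≢x M (just j)) (proj₁ (free⇒ Ab≡free))) ⟨
          weight M′                                         ∎
      }
      where
      open Invariant inv
      A′ = update A (N j) (augment₃ x b)
      M′ = (M [ x ]≔ just j) [ b ]≔ just y
      cL′ = cL [ x ]%= ℕ.suc
      cR′ = cR [ y ]%= ℕ.suc
      Zʸ = charge y (δ * lookup w b) Z
      Z′ = charge j (κ * lookup w b) Zʸ
      b≢x : b ≢ x
      b≢x refl = contradiction (trans (sym Ab≡free) Ax≡live) λ ()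
      y∉js : ¬ y List.∈ js
      y∉js y∈ = mate-arrived Mx≡y (there y∈)
      0≤δwb : 0# ≤ δ * lookup w b
      0≤δwb = *-nonNegative 0≤δ (0≤w b)
      0≤κwb : 0# ≤ κ * lookup w b
      0≤κwb = *-nonNegative 0≤κ (0≤w b)
      Z≤Z′ : ∀ k → Z k ≤ Z′ k
      Z≤Z′ k = ≤-trans (charge-≥ Z 0≤δwb k) (charge-≥ Zʸ 0≤κwb k)
      κwb≤Z′j : κ * lookup w b ≤ Z′ j
      κwb≤Z′j = charge-at-≥ Zʸ (≤-trans (Z-nonNegative j) (charge-≥ Z 0≤δwb j))
      unchanged : ∀ {i} → i ≢ x → i ≢ b → lookup M′ i ≡ lookup M i
      unchanged i≢x i≢b = trans (lookup∘update′ i≢b (M [ x ]≔ just j) (just y)) (lookup∘update′ i≢x M (just j))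
      unfrozen⁻ : ∀ {i s} → s ≢ frozen → lookup A′ i ≡ s → i ≢ x × i ≢ b × lookup A i ≡ s
      unfrozen⁻ s≢frozen A′i≡
        with i≢b , A″i≡ ← lookup-≔-other⁻ (A [ x ]≔ frozen) s≢frozen A′i≡
        with i≢x , Ai≡ ← lookup-≔-other⁻ A s≢frozen A″i≡ = i≢x , i≢b , Ai≡
      still : ∀ {i} → i ≢ x → i ≢ b → lookup A′ i ≡ lookup A i
      still i≢x i≢b = trans (lookup∘update′ i≢b (A [ x ]≔ frozen) frozen) (lookup∘update′ i≢x A frozen)
      direct⁻ : ∀ {S i} → Direct A′ S i → Direct A S i
      direct⁻ (i∈S , A′i≡) = i∈S , proj₂ (proj₂ (unfrozen⁻ (λ ()) A′i≡))
      mate⁻ : ∀ {i k} → lookup M′ i ≡ just k →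
              (i ≡ b × k ≡ y) ⊎ (i ≡ x × k ≡ j) ⊎ (i ≢ x × lookup M i ≡ just k)
      mate⁻ M′i≡ with lookup-≔⁻ (M [ x ]≔ just j) M′i≡
      ... | inj₁ (i≡b , k≡y) = inj₁ (i≡b , just-injective k≡y)
      ... | inj₂ (_ , M″i≡) with lookup-≔⁻ M M″i≡
      ...   | inj₁ (i≡x , k≡j) = inj₂ (inj₁ (i≡x , just-injective k≡j))
      ...   | inj₂ old         = inj₂ (inj₂ old)
      mate-of-y : ∀ {i} → lookup M i ≡ just y → i ≡ x
      mate-of-y Mi≡ = mate-injective Mi≡ Mx≡y
      free⇒′ : ∀ {i} → lookup A′ i ≡ free → lookup M′ i ≡ nothing × lookup cL′ i ≡ 0
      free⇒′ A′i≡ with i≢x , i≢b , Ai≡ ← unfrozen⁻ (λ ()) A′i≡ =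
        trans (unchanged i≢x i≢b) (proj₁ (free⇒ Ai≡)) ,
        trans (lookup∘updateAt′ _ x i≢x cL) (proj₂ (free⇒ Ai≡))
      frozen⇒′ : ∀ {i} → lookup A′ i ≡ frozen → ∃[ k ] lookup M′ i ≡ just k
      frozen⇒′ {i} A′i≡ with i Fin.≟ b
      ... | yes refl = y , lookup∘update b (M [ x ]≔ just j) (just y)
      ... | no i≢b with i Fin.≟ x
      ...   | yes refl = j , trans (lookup∘update′ i≢b (M [ x ]≔ just j) (just y)) (lookup∘update x M (just j))
      ...   | no i≢x with k , Mi≡ ← frozen⇒ (trans (sym (still i≢x i≢b)) A′i≡) =
        k , trans (unchanged i≢x i≢b) Mi≡
      live⇒′ : ∀ {i S} → lookup A′ i ≡ live S →
               ∃[ k ] lookup M′ i ≡ just k × N k ≡ S × lookup cL′ i ≡ 0 × lookup cR′ k ≡ 0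
      live⇒′ A′i≡
        with i≢x , i≢b , Ai≡ ← unfrozen⁻ (λ ()) A′i≡
        with k , Mi≡ , Nk≡ , cLi≡0 , cRk≡0 ← live⇒ Ai≡ =
        k , trans (unchanged i≢x i≢b) Mi≡ , Nk≡ ,
        trans (lookup∘updateAt′ _ x i≢x cL) cLi≡0 ,
        trans (lookup∘updateAt′ k y (λ { refl → i≢x (mate-of-y Mi≡) }) cR) cRk≡0
      mate-arrived′ : ∀ {i k} → lookup M′ i ≡ just k → ¬ k List.∈ js
      mate-arrived′ M′i≡ with mate⁻ M′i≡
      ... | inj₁ (_ , refl)        = y∉js
      ... | inj₂ (inj₁ (_ , refl)) = j∉js
      ... | inj₂ (inj₂ (_ , Mi≡))  = λ k∈ → mate-arrived Mi≡ (there k∈)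
      j-unmatched : ∀ {i} → lookup M i ≢ just j
      j-unmatched Mi≡ = mate-arrived Mi≡ (here refl)
      mate-injective′ : MateInjective M′
      mate-injective′ M′i≡ M′i′≡ with mate⁻ M′i≡ | mate⁻ M′i′≡
      ... | inj₁ (refl , _)         | inj₁ (refl , _)            = refl
      ... | inj₁ (_ , refl)         | inj₂ (inj₁ (_ , refl))     = contradiction Mx≡y j-unmatched
      ... | inj₁ (_ , refl)         | inj₂ (inj₂ (i≢x , Mi≡))    = contradiction (mate-of-y Mi≡) i≢x
      ... | inj₂ (inj₁ (_ , refl))  | inj₁ (_ , refl)            = contradiction Mx≡y j-unmatched
      ... | inj₂ (inj₁ (refl , _))  | inj₂ (inj₁ (refl , _))     = refl
      ... | inj₂ (inj₁ (_ , refl))  | inj₂ (inj₂ (_ , Mi≡))      = contradiction Mi≡ j-unmatched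
      ... | inj₂ (inj₂ (i≢x , Mi≡)) | inj₁ (_ , refl)            = contradiction (mate-of-y Mi≡) i≢x
      ... | inj₂ (inj₂ (_ , Mi≡))   | inj₂ (inj₁ (_ , refl))     = contradiction Mi≡ j-unmatched
      ... | inj₂ (inj₂ (_ , Mi≡))   | inj₂ (inj₂ (_ , Mi′≡))     = mate-injective Mi≡ Mi′≡
      direct-bound′ : ∀ {k i} → ¬ k List.∈ js → Direct A′ (N k) i →
                      (1# + δ) * lookup w i ≤ Z′ k ⊎
                      (∃[ a ] ∃[ S ] lookup A′ a ≡ live S × lookup M′ a ≡ just k × lookup w i ≤ Z′ k)
      direct-bound′ {k} {i} k∉ d with arrived-cases {j = j} k k∉
      ... | inj₁ refl = inj₁ (begin
        (1# + δ) * lookup w i        ≤⟨ *-monoˡ-≤ (+-nonNegative 0≤1 0≤δ) (max₁ (direct⁻ d)) ⟩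
        (1# + δ) * (δ * lookup w b)  ≡⟨ *-assoc (1# + δ) δ (lookup w b) ⟨
        (1# + δ) * δ * lookup w b    ≡⟨ cong (_* lookup w b) [1+δ]δ≡κ ⟩
        κ * lookup w b               ≤⟨ κwb≤Z′j ⟩
        Z′ j                         ∎)
      ... | inj₂ k∉′ with direct-bound k∉′ (direct⁻ d)
      ...   | inj₁ bound = inj₁ (≤-trans bound (Z≤Z′ k))
      ...   | inj₂ (a , S , Aa≡ , Ma≡ , bound) with a Fin.≟ x
      ...     | no a≢x = inj₂ (a , S ,
        trans (still a≢x a≢b) Aa≡ ,
        trans (unchanged a≢x a≢b) Ma≡ , ≤-trans bound (Z≤Z′ k))
        where
        a≢b : a ≢ b
        a≢b refl = contradiction (trans (sym Ab≡free) Aa≡) λ ()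
      -- The pair (x , y) ceases to be live, so y moves to the first alternative. As j could also
      -- have reached i through x, the choice of b gives w(i) ≤ w(b).
      ...     | yes refl with refl ← just-injective (trans (sym Ma≡) Mx≡y) = inj₁ (begin
        (1# + δ) * lookup w i               ≡⟨ [1+δ]w≡w+δw i ⟩
        lookup w i + δ * lookup w i         ≤⟨ +-mono-≤ bound (*-monoˡ-≤ 0≤δ (max₃ (x∈Nj , N y , Ax≡live , direct⁻ d))) ⟩
        Z y + δ * lookup w b                ≡⟨ charge-at y _ Z ⟨
        Zʸ y                                ≤⟨ charge-≥ Zʸ 0≤κwb y ⟩
        Z′ y                                ∎)
      reroute-bound′ : ∀ {k z i} → ¬ k List.∈ js → Reroute A′ (N k) (z , i) → δ * lookup w i ≤ Z′ k
      reroute-bound′ {k} {z} {i} k∉ (z∈N , S , A′z≡ , d)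
        with _ , _ , Az≡ ← unfrozen⁻ (λ ()) A′z≡ | arrived-cases {j = j} k k∉
      ... | inj₂ k∉′ = ≤-trans (reroute-bound k∉′ (z∈N , S , Az≡ , direct⁻ d)) (Z≤Z′ k)
      ... | inj₁ refl = begin
        δ * lookup w i  ≤⟨ *-monoˡ-≤ 0≤δ (max₃ (z∈N , S , Az≡ , direct⁻ d)) ⟩
        δ * lookup w b  ≤⟨ *-monoʳ-≤ (0≤w b) δ≤κ ⟩
        κ * lookup w b  ≤⟨ κwb≤Z′j ⟩
        Z′ j            ∎

    step : ∀ {j js A σ Z d} → ¬ j List.∈ js → Choice w A (N j) d → Invariant (j ∷ js) A σ Z →
           ∃[ σ′ ] ∃[ Z′ ] Step 1 1 G j σ d σ′ × Invariant js (update A (N j) d) σ′ Z′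
    step j∉js (leave none₁ none₃) inv = _ , _ , leave , leave-invariant inv none₁ none₃
    step j∉js (augment₁ d@(a∈N , Aa≡free) max₁ max₃) inv = _ , _ ,
      augment₁ a∈N (proj₁ (Invariant.free⇒ inv Aa≡free)) ,
      augment₁-invariant j∉js inv d max₁ max₃
    step j∉js (augment₃ (x∈N , S , Ax≡live , d@(b∈S , Ab≡free)) max₁ max₃) inv
      with y , Mx≡y , refl , cLx≡0 , cRy≡0 ← Invariant.live⇒ inv Ax≡live = _ , _ ,
      augment₃ x∈N Mx≡y b∈S (proj₁ (Invariant.free⇒ inv Ab≡free))
        (ℕ.≤-reflexive (cong ℕ.suc cLx≡0)) (ℕ.≤-reflexive (cong ℕ.suc cRy≡0)) ,
      augment₃-invariant j∉js inv x∈N Ax≡live Mx≡y d max₁ max₃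

    -- The dual solution after the last arrival.

    module _ {A : Profile l} {σ : State l r} {Z : Fin r → ℝ} (inv : Invariant [] A σ Z) where
      open State σ
      open Invariant inv

      -- The m of the transfers. The default 0 makes the transfer vanish when no free neighbour is
      -- left.
      best : Subset l → ℝ
      best S with bestDirect w A S
      ... | inj₁ (i , _) = lookup w i
      ... | inj₂ _       = 0#

      0≤best : ∀ S → 0# ≤ best S
      0≤best S with bestDirect w A S
      ... | inj₁ (i , _) = 0≤w i
      ... | inj₂ _       = ≤-refl

      w≤best : ∀ {S i} → Direct A S i → lookup w i ≤ best S
      w≤best {S} d with bestDirect w A S
      ... | inj₁ (_ , _ , max) = max d
      ... | inj₂ none          = contradiction d none

      δbest≤ : ∀ {S B} → 0# ≤ B → (∀ {i} → Direct A S i → δ * lookup w i ≤ B) → δ * best S ≤ B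
      δbest≤ {S} {B} 0≤B bound with bestDirect w A S
      ... | inj₁ (_ , d , _) = bound d
      ... | inj₂ _           = subst (_≤ B) (sym (zeroʳ δ)) 0≤B

      transfer : Status l → ℝ
      transfer (live S) = δ * best S
      transfer _        = 0#

      0≤transfer : ∀ s → 0# ≤ transfer s
      0≤transfer free     = ≤-refl
      0≤transfer frozen   = ≤-refl
      0≤transfer (live S) = *-nonNegative 0≤δ (0≤best S)

      -- `u i` is the amount that i passes to its mate, `full i` its price before passing it.
      u full : Fin l → ℝ
      u i    = transfer (lookup A i)
      full i = if is-just (lookup M i) then (1# + δ) * lookup w i else 0#

      full-matched : ∀ {i j} → lookup M i ≡ just j → full i ≡ (1# + δ) * lookup w i
      full-matched {i} Mi≡ = cong (λ m → if is-just m then (1# + δ) * lookup w i else 0#) Mi≡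

      0≤full : ∀ i → 0# ≤ full i
      0≤full i = if-nonNegative (is-just (lookup M i))
        (*-nonNegative (+-nonNegative 0≤1 0≤δ) (0≤w i))

      share : Fin r → Fin l → ℝ
      share j i = if does (mate? M i j) then u i else 0#

      -- The amount that j receives, written as a sum over all of L so that it can be compared with
      -- `sum u` by exchanging summations.
      E : Fin r → ℝ
      E j = sum (share j)

      0≤share : ∀ j i → 0# ≤ share j i
      0≤share j i = if-nonNegative (does (mate? M i j)) (0≤transfer (lookup A i))

      u≤E : ∀ {i j} → lookup M i ≡ just j → u i ≤ E j
      u≤E {i} {j} Mi≡ = ≤-trans u≤share (term≤sum (0≤share j) i)
        where
        u≤share : u i ≤ share j i
        u≤share with mate? M i j
        ... | yes _    = ≤-refl
        ... | no Mi≢j = contradiction Mi≡ Mi≢j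

      sum-E≤sum-u : sum E ≤ sum u
      sum-E≤sum-u = subst (_≤ sum u) (sym (∑-comm share))
        (sum-mono-≤ λ i → sum-unique-≤ (mate? M i) (0≤transfer (lookup A i))
          λ Mi≡j Mi≡k → just-injective (trans (sym Mi≡j) Mi≡k))

      -- Keeps the reduced price of i nonnegative: by `live-bound`, a live i passes on at most δ
      -- w(i).
      u≤full : ∀ i → u i ≤ full i
      u≤full i with lookup A i in Ai≡
      ... | free   = 0≤full i
      ... | frozen = 0≤full i
      ... | live S with _ , Mi≡ , _ ← live⇒ Ai≡ = begin
        δ * best S             ≤⟨ δbest≤ (*-nonNegative 0≤δ (0≤w i)) (λ d → *-monoˡ-≤ 0≤δ (live-bound Ai≡ d)) ⟩
        δ * lookup w i         ≤⟨ δw≤w i ⟩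
        lookup w i             ≤⟨ w≤[1+δ]w i ⟩
        (1# + δ) * lookup w i  ≡⟨ full-matched Mi≡ ⟨
        full i                 ∎

      -- Dual feasibility on the edge, with `u i` moved to the left. A frozen i passes nothing on
      -- and pays alone. For a live i the transfer is matched by `Z j` through `reroute-bound`. For
      -- a free i, j pays everything: from its charge, or from a charge of w(i) and the transfer of
      -- its live mate.
      covered : ∀ {i j} → i ∈ N j → (1# + δ) * lookup w i + u i ≤ full i + (Z j + E j)
      covered {i} {j} i∈N with lookup A i in Ai≡
      ... | frozen with _ , Mi≡ ← frozen⇒ Ai≡ =
        +-mono-≤ (≤-reflexive (sym (full-matched Mi≡)))
          (+-nonNegative (Z-nonNegative j) (sum-nonNegative (0≤share j)))
      ... | live S with _ , Mi≡ , _ ← live⇒ Ai≡ =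
        +-mono-≤ (≤-reflexive (sym (full-matched Mi≡)))
          (≤-trans (δbest≤ (Z-nonNegative j) λ d → reroute-bound (λ ()) (i∈N , S , Ai≡ , d))
            (x≤x+y (sum-nonNegative (0≤share j))))
      ... | free = begin
        (1# + δ) * lookup w i + 0#  ≡⟨ +-identityʳ _ ⟩
        (1# + δ) * lookup w i       ≤⟨ bound ⟩
        Z j + E j                   ≤⟨ x≤y+x (0≤full i) ⟩
        full i + (Z j + E j)        ∎
        where
        bound : (1# + δ) * lookup w i ≤ Z j + E j
        bound with direct-bound (λ ()) (i∈N , Ai≡)
        ... | inj₁ w≤Z = ≤-trans w≤Z (x≤x+y (sum-nonNegative (0≤share j)))
        ... | inj₂ (a , S , Aa≡ , Ma≡j , w≤Z)
          with k , Ma≡k , refl , _ ← live⇒ Aa≡ with refl ← just-injective (trans (sym Ma≡j) Ma≡k) = begin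
          (1# + δ) * lookup w i        ≡⟨ [1+δ]w≡w+δw i ⟩
          lookup w i + δ * lookup w i  ≤⟨ +-mono-≤ w≤Z (*-monoˡ-≤ 0≤δ (w≤best (i∈N , Ai≡))) ⟩
          Z j + δ * best (N j)         ≡⟨ cong (λ s → Z j + transfer s) Aa≡ ⟨
          Z j + u a                    ≤⟨ +-monoʳ-≤ (Z j) (u≤E Ma≡j) ⟩
          Z j + E j                    ∎

      -- Weak duality with prices full i − u i on L and Z j + E j on R; u and E
      -- cancel in the total.
      bound-scaled : ∀ {M*} → IsMatching G M* → (1# + δ) * weight M* ≤ (2# + δ) * weight M
      bound-scaled {M*} isMatching = begin
        (1# + δ) * weight M*
          ≡⟨ *-distribˡ-coveredSum (1# + δ) (lookup w) M* ⟩
        coveredSum (λ i → (1# + δ) * lookup w i) M*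
          ≤⟨ weak-duality M* (IsMatching.injective isMatching) (λ i → x≤y⇒0≤y-x (u≤full i))
               (λ j → +-nonNegative (Z-nonNegative j) (sum-nonNegative (0≤share j)))
               (λ {i} Mi≡ → shift (u i) (covered (IsMatching.edge isMatching Mi≡))) ⟩
        sum (λ i → full i - u i) + sum (λ j → Z j + E j)
          ≡⟨ cong (sum (λ i → full i - u i) +_) (∑-distrib-+ Z E) ⟩
        sum (λ i → full i - u i) + (sum Z + sum E)
          ≤⟨ +-monoʳ-≤ _ (+-monoʳ-≤ _ sum-E≤sum-u) ⟩
        sum (λ i → full i - u i) + (sum Z + sum u)
          ≡⟨ solve 3 (λ a b c → a :+ (b :+ c) := c :+ a :+ b) refl (sum (λ i → full i - u i)) (sum Z) (sum u) ⟩
        sum u + sum (λ i → full i - u i) + sum Z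
          ≡⟨ cong (_+ sum Z) (∑-distrib-+ u _) ⟨
        sum (λ i → u i + (full i - u i)) + sum Z
          ≡⟨ cong (_+ sum Z) (sum-cong-≗ λ i → x+[y-x]≡y (u i) (full i)) ⟩
        sum full + sum Z
          ≡⟨ cong (_+ sum Z) (*-distribˡ-coveredSum (1# + δ) (lookup w) M) ⟨
        (1# + δ) * weight M + sum Z
          ≡⟨ cong ((1# + δ) * weight M +_) total-charge ⟩
        (1# + δ) * weight M + weight M
          ≡⟨ solve 2 (λ δ x → (con 1 :+ δ) :* x :+ x := (con 2 :+ δ) :* x) refl δ (weight M) ⟩
        (2# + δ) * weight M ∎
        where
        shift : ∀ {a f z} u → a + u ≤ f + z → a ≤ f - u + z
        shift {a} {f} {z} u a+u≤f+z = +-cancelˡ-≤ u (subst₂ _≤_ (+-comm a u)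
          (begin-equality
            f + z              ≡⟨ cong (_+ z) (x+[y-x]≡y u f) ⟨
            u + (f - u) + z    ≡⟨ +-assoc u (f - u) z ⟩
            u + (f - u + z)    ∎) a+u≤f+z)

      -- Multiplication by δ turns the factors 1 + δ and 2 + δ into κ and 1.
      competitive-bound : ∀ {M*} → IsMatching G M* → κ * weight M* ≤ weight M
      competitive-bound {M*} isMatching = begin
        κ * weight M*                 ≡⟨ cong (_* weight M*) (trans (*-comm δ (1# + δ)) [1+δ]δ≡κ) ⟨
        δ * (1# + δ) * weight M*      ≡⟨ *-assoc δ (1# + δ) (weight M*) ⟩
        δ * ((1# + δ) * weight M*)    ≤⟨ *-monoˡ-≤ 0≤δ (bound-scaled isMatching) ⟩
        δ * ((2# + δ) * weight M)     ≡⟨ *-assoc δ (2# + δ) (weight M) ⟨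
        δ * (2# + δ) * weight M       ≡⟨ cong (_* weight M) (trans (*-comm δ (2# + δ)) [2+δ]δ≡1) ⟩
        1# * weight M                 ≡⟨ *-identityˡ (weight M) ⟩
        weight M                      ∎

-- Running the greedy policy on an instance.

module GreedyAlgorithm (reals : RealNumbers) where
  open RealNumbers reals
  open SilverRatio reals
  open WOMP₃ reals 1 1
  open Greedy reals using (choose; simulate; decide)
  open Charging reals using (Invariant; initial-invariant; step; competitive-bound)

  module _ (I : Instance) where
    open Instance I

    -- Execution and invariant are built together, since the legality of each step rests on the
    -- invariant. The state reached is then by definition the one to which the final bound applies.
    run : ∀ js past {σ Z} → Unique js → Invariant G w js (simulate w past) σ Z →
          ∃[ σ′ ] Execution decide I past σ js σ′ ×
            ∃[ A′ ] ∃[ Z′ ] Invariant G w [] A′ σ′ Z′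
    run []       past []        inv = _ , done , _ , _ , inv
    run (j ∷ js) past (j≢ ∷ us) inv
      with _ , _ , s , inv₁ ← step G w nonNegative (All.All¬⇒¬Any j≢) (proj₂ (choose w (simulate w past) (N j))) inv
      with _ , ex , final ← run js (N j ∷ past) us inv₁ = _ , arrive s ex , final

    arrivals-unique : Unique arrivals
    arrivals-unique = Unique.tabulate⁺ (Injection.injective (↔⇒↣ π))

    arrives : ∀ j → j List.∈ arrivals
    arrives j = subst (List._∈ arrivals) (inverseʳ π) (∈-tabulate⁺ {f = π ⟨$⟩ʳ_} (π ⟨$⟩ˡ j))

    full-run : ∃[ σ′ ] Execution decide I [] initial arrivals σ′ ×
                 ∃[ A′ ] ∃[ Z′ ] Invariant G w [] A′ σ′ Z′
    full-run = run arrivals [] arrivals-unique (initial-invariant G w arrives)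

  algorithm : Algorithm
  algorithm = record
    { decide = decide
    ; legal  = λ I → proj₁ (full-run I) , proj₁ (proj₂ (full-run I))
    }

  algorithm-competitive : Competitive algorithm κ
  algorithm-competitive I M* (isMatching , _) =
    competitive-bound G w nonNegative (proj₂ (proj₂ (proj₂ (proj₂ (full-run I))))) isMatching
    where open Instance I

-- The adversary

-- A vertex whose sole neighbour a is matched could gain only by rerouting the edge at a. That is
-- blocked once a or its mate y has been reassigned, or when y has no free neighbour.
only-leave : ∀ {l r} {G : BipartiteGraph l r} {j M cL cR d σ′ a y} →
             BipartiteGraph.N G j ≡ ⁅ a ⁆ → lookup M a ≡ just y →
             lookup cL a ≡ 1 ⊎ lookup cR y ≡ 1 ⊎
               (∀ {k} → k ∈ BipartiteGraph.N G y → lookup M k ≢ nothing) →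
             Step 1 1 G j (state M cL cR) d σ′ → σ′ ≡ state M cL cR
only-leave N≡ Ma≡y blocked leave = refl
only-leave {a = a} N≡ Ma≡y blocked (augment₁ i∈N Mi≡)
  with refl ← x∈⁅y⁆⇒x≡y a (subst (_ ∈_) N≡ i∈N) =
  contradiction (trans (sym Ma≡y) Mi≡) λ ()
only-leave {a = a} N≡ Ma≡y blocked (augment₃ x∈N Mx≡ k∈N Mk≡ cL<1 cR<1)
  with refl ← x∈⁅y⁆⇒x≡y a (subst (_ ∈_) N≡ x∈N)
  with refl ← just-injective (trans (sym Ma≡y) Mx≡) with blocked
... | inj₁ cL≡1          = contradiction (subst (ℕ._< 1) cL≡1 cL<1) λ { (s≤s ()) }
... | inj₂ (inj₁ cR≡1)   = contradiction (subst (ℕ._< 1) cR≡1 cR<1) λ { (s≤s ()) }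
... | inj₂ (inj₂ taken)  = contradiction Mk≡ (taken k∈N)

module Adversary (reals : RealNumbers) where
  open RealNumbers reals
  open OrderedField reals
  open SilverRatio reals
  open FiniteSums reals
  open WOMP₃ reals 1 1

  w : Vec ℝ 4
  w = 1# ∷ 1# ∷ 1# ∷ δ ∷ []

  0≤w : ∀ i → 0# ≤ lookup w i
  0≤w 0F = 0≤1
  0≤w 1F = 0≤1
  0≤w 2F = 0≤1
  0≤w 3F = 0≤δ

  w≤1 : ∀ i → lookup w i ≤ 1#
  w≤1 0F = ≤-refl
  w≤1 1F = ≤-refl
  w≤1 2F = ≤-refl
  w≤1 3F = subst (δ ≤_) δ+κ≡1 (x≤x+y 0≤κ)

  weight : ∀ {r} → Mates 4 r → ℝ
  weight = coveredSum (lookup w)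

  heavy : Subset 4
  heavy = inside ∷ inside ∷ inside ∷ outside ∷ []

  w-heavy : ∀ {i} → i ∈ heavy → lookup w i ≡ 1#
  w-heavy here                 = refl
  w-heavy (there here)         = refl
  w-heavy (there (there here)) = refl
  w-heavy (there (there (there (there ()))))

  3∉heavy : ¬ 3F ∈ heavy
  3∉heavy (there (there (there ())))

  graph : ∀ {r} → Vec (Subset 4) r → BipartiteGraph 4 r
  graph Ns = record { N = lookup Ns }

  arriving : ∀ {r} → Vec (Subset 4) r → Instance
  arriving Ns = record { G = graph Ns ; π = Permutation.id ; w = w ; nonNegative = 0≤w }

  -- The three families of instances share prefixes, and a policy must answer equal prefixes
  -- equally. `Ns₁` punishes leaving the first vertex unmatched; x and i below stand for the answers
  -- to the first two arrivals.
  Ns₁ : Vec (Subset 4) 1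
  Ns₁ = heavy ∷ []

  Ns₃ : Fin 4 → Vec (Subset 4) 3
  Ns₃ x = heavy ∷ ⁅ x ⁆ ∪ ⁅ 3F ⁆ ∷ ⁅ 3F ⁆ ∷ []

  Ns₄ : Fin 4 → Fin 4 → Vec (Subset 4) 4
  Ns₄ x i = heavy ∷ ⁅ x ⁆ ∪ ⁅ 3F ⁆ ∷ ⁅ x ⁆ ∷ ⁅ i ⁆ ∷ []

  opt₁ : Mates 4 1
  opt₁ = just 0F ∷ nothing ∷ nothing ∷ nothing ∷ []

  -- The second arrival takes x, the third the light vertex, and the first a heavy vertex other than
  -- x. The last clause is meant for x = 2.
  opt₃ : Fin 4 → Mates 4 3
  opt₃ 0F            = just 1F ∷ just 0F ∷ nothing ∷ just 2F ∷ []
  opt₃ 1F            = just 0F ∷ just 1F ∷ nothing ∷ just 2F ∷ []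
  opt₃ (suc (suc _)) = just 0F ∷ nothing ∷ just 1F ∷ just 2F ∷ []

  -- All of L is first given to arrival 0; for distinct heavy x and i, the three overwrites leave it
  -- exactly the remaining heavy vertex.
  opt₄ : Fin 4 → Fin 4 → Mates 4 4
  opt₄ x i = ((replicate 4 (just 0F) [ x ]≔ just 2F) [ i ]≔ just 3F) [ 3F ]≔ just 1F

  weight-opt₁ : weight opt₁ ≡ 1#
  weight-opt₁ = solve 0 (con 1 :+ (con 0 :+ (con 0 :+ (con 0 :+ con 0))) := con 1) refl

  weight-opt₃ : ∀ x → weight (opt₃ x) ≡ 2# + δ
  weight-opt₃ 0F = solve 1 (λ δ → con 1 :+ (con 1 :+ (con 0 :+ (δ :+ con 0))) := con 2 :+ δ) refl δ
  weight-opt₃ 1F = solve 1 (λ δ → con 1 :+ (con 1 :+ (con 0 :+ (δ :+ con 0))) := con 2 :+ δ) refl δ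
  weight-opt₃ (suc (suc _)) = solve 1 (λ δ → con 1 :+ (con 0 :+ (con 1 :+ (δ :+ con 0))) := con 2 :+ δ) refl δ

  weight-opt₄ : ∀ x i → weight (opt₄ x i) ≡ sum (lookup w)
  weight-opt₄ x i = sum-cong-≗ λ k → cong (if_then lookup w k else 0#) (perfect x i k)
    where
    perfect : ∀ x i k → is-just (lookup (opt₄ x i) k) ≡ true
    perfect = from-yes (Fin.all? λ x → Fin.all? λ i → Fin.all? λ k →
      is-just (lookup (opt₄ x i) k) Bool.≟ true)

  opt₁-maximum : Instance.IsMaximumMatching (arriving Ns₁) opt₁
  opt₁-maximum = from-yes (isMatching? (graph Ns₁) opt₁) , λ M′ m → begin
    weight M′                           ≤⟨ weak-duality M′ (IsMatching.injective m) (λ _ → ≤-refl) (λ _ → 0≤1)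
                                             (λ {i} _ → subst (lookup w i ≤_) (sym (+-identityˡ 1#)) (w≤1 i)) ⟩
    sum {4} (λ _ → 0#) + sum {1} (λ _ → 1#)  ≡⟨ solve 0 (con 0 :+ (con 0 :+ (con 0 :+ (con 0 :+ con 0))) :+ (con 1 :+ con 0) := con 1) refl ⟩
    1#                                  ≡⟨ weight-opt₁ ⟨
    weight opt₁                         ∎

  opt₃-maximum : ∀ {x} → x ∈ heavy → Instance.IsMaximumMatching (arriving (Ns₃ x)) (opt₃ x)
  opt₃-maximum {x} x∈heavy = matching x x∈heavy , λ M′ m → begin
    weight M′                        ≤⟨ weak-duality M′ (IsMatching.injective m) 0≤y 0≤z (λ {i} {j} M′i≡ → covers i j (IsMatching.edge m M′i≡)) ⟩
    sum (lookup y) + sum (lookup z)  ≡⟨ solve 1 (λ δ → (con 0 :+ (con 0 :+ (con 0 :+ (δ :+ con 0)))) :+ (con 1 :+ (con 1 :+ (con 0 :+ con 0))) := con 2 :+ δ) refl δ ⟩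
    2# + δ                           ≡⟨ weight-opt₃ x ⟨
    weight (opt₃ x)                  ∎
    where
    matching : ∀ x → x ∈ heavy → IsMatching (graph (Ns₃ x)) (opt₃ x)
    matching = from-yes (Fin.all? λ x → (x ∈? heavy) →-dec isMatching? (graph (Ns₃ x)) (opt₃ x))
    -- Dual certificate of value 2 + δ: only the first two arrivals see heavy vertices and cost 1
    -- each; the light vertex pays for itself.
    y : Vec ℝ 4
    y = 0# ∷ 0# ∷ 0# ∷ δ ∷ []
    z : Vec ℝ 3
    z = 1# ∷ 1# ∷ 0# ∷ []
    0≤y : ∀ i → 0# ≤ lookup y i
    0≤y 0F = ≤-refl
    0≤y 1F = ≤-refl
    0≤y 2F = ≤-refl
    0≤y 3F = 0≤δ
    0≤z : ∀ j → 0# ≤ lookup z j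
    0≤z 0F = 0≤1
    0≤z 1F = 0≤1
    0≤z 2F = ≤-refl
    covers : ∀ i j → i ∈ lookup (Ns₃ x) j → lookup w i ≤ lookup y i + lookup z j
    covers i 0F _ = ≤-trans (w≤1 i) (x≤y+x (0≤y i))
    covers i 1F _ = ≤-trans (w≤1 i) (x≤y+x (0≤y i))
    covers i 2F i∈ with refl ← x∈⁅y⁆⇒x≡y 3F i∈ = x≤x+y ≤-refl

  -- All of L is covered, so no matching can weigh more.
  opt₄-maximum : ∀ {x i} → x ∈ heavy → i ∈ heavy → i ≢ x →
                 Instance.IsMaximumMatching (arriving (Ns₄ x i)) (opt₄ x i)
  opt₄-maximum {x} {i} x∈heavy i∈heavy i≢x = matching x x∈heavy i i∈heavy i≢x , λ M′ _ →
    subst (weight M′ ≤_) (sym (weight-opt₄ x i)) (sum-mono-≤ λ k → if-≤ (is-just (lookup M′ k)) (0≤w k))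
    where
    matching : ∀ x → x ∈ heavy → ∀ i → i ∈ heavy → i ≢ x → IsMatching (graph (Ns₄ x i)) (opt₄ x i)
    matching = from-yes (Fin.all? λ x → (x ∈? heavy) →-dec Fin.all? λ i → (i ∈? heavy) →-dec
      (¬? (i Fin.≟ x) →-dec isMatching? (graph (Ns₄ x i)) (opt₄ x i)))
    if-≤ : ∀ b {a} → 0# ≤ a → (if b then a else 0#) ≤ a
    if-≤ true _          = ≤-refl
    if-≤ false 0≤a = 0≤a

  -- Replaces the computed decision by a variable with an equation, which makes case analysis on the
  -- step possible.
  peel : ∀ {decide : Policy} {I past σ j js σ′} → Execution decide I past σ (j ∷ js) σ′ →
         ∃[ d ] d ≡ decide (Instance.w I) past (Instance.N I j) × ∃[ σ₁ ]
           Step 1 1 (Instance.G I) j σ d σ₁ ×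
           Execution decide I (Instance.N I j ∷ past) σ₁ js σ′
  peel (arrive s rest) = _ , refl , _ , s , rest

  -- The inverse of 2 + δ is δ.
  ρ[2+δ]≤1+δ⇒ρ≤κ : ∀ {ρ} → ρ * (2# + δ) ≤ 1# + δ → ρ ≤ κ
  ρ[2+δ]≤1+δ⇒ρ≤κ {ρ} bound = begin
    ρ                      ≡⟨ *-identityʳ ρ ⟨
    ρ * 1#                 ≡⟨ cong (ρ *_) [2+δ]δ≡1 ⟨
    ρ * ((2# + δ) * δ)     ≡⟨ *-assoc ρ (2# + δ) δ ⟨
    ρ * (2# + δ) * δ       ≤⟨ *-monoʳ-≤ 0≤δ bound ⟩
    (1# + δ) * δ           ≡⟨ [1+δ]δ≡κ ⟩
    κ                      ∎

  -- The total weight is 3 + δ, and (3 + δ) κ = 2; multiplying by κ leaves a factor 2 on both sides.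
  ρ[3+δ]≤2⇒ρ≤κ : ∀ {ρ} → ρ * sum (lookup w) ≤ 2# → ρ ≤ κ
  ρ[3+δ]≤2⇒ρ≤κ {ρ} bound = x+x≤y+y⇒x≤y (begin
    ρ + ρ                       ≡⟨ solve 1 (λ ρ → ρ :+ ρ := ρ :* con 2) refl ρ ⟩
    ρ * 2#                      ≡⟨ cong (ρ *_) [3+δ]κ≡2 ⟨
    ρ * (sum (lookup w) * κ)    ≡⟨ *-assoc ρ (sum (lookup w)) κ ⟨
    ρ * sum (lookup w) * κ      ≤⟨ *-monoʳ-≤ 0≤κ bound ⟩
    2# * κ                      ≡⟨ solve 1 (λ κ → con 2 :* κ := κ :+ κ) refl κ ⟩
    κ + κ                       ∎)
    where
    [3+δ]κ≡2 : sum (lookup w) * κ ≡ 2#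
    [3+δ]κ≡2 = begin-equality
      sum (lookup w) * κ
        ≡⟨ solve 2 (λ δ κ → (con 1 :+ (con 1 :+ (con 1 :+ (δ :+ con 0)))) :* κ := (con 2 :+ δ) :* κ :+ κ) refl δ κ ⟩
      (2# + δ) * κ + κ                   ≡⟨ cong (λ c → (2# + δ) * c + κ) [1+δ]δ≡κ ⟨
      (2# + δ) * ((1# + δ) * δ) + κ      ≡⟨ solve 2 (λ δ κ → (con 2 :+ δ) :* ((con 1 :+ δ) :* δ) :+ κ := (con 2 :+ δ) :* δ :* (con 1 :+ δ) :+ κ) refl δ κ ⟩
      (2# + δ) * δ * (1# + δ) + κ        ≡⟨ cong (λ c → c * (1# + δ) + κ) [2+δ]δ≡1 ⟩
      1# * (1# + δ) + κ                  ≡⟨ solve 2 (λ δ κ → con 1 :* (con 1 :+ δ) :+ κ := con 1 :+ (δ :+ κ)) refl δ κ ⟩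
      1# + (δ + κ)                       ≡⟨ cong (1# +_) δ+κ≡1 ⟩
      2#                                 ∎

  ∅ : ∀ {r} → Mates 4 r
  ∅ = replicate 4 nothing

  weight-single : ∀ {r x} {j : Fin r} → x ∈ heavy → weight (∅ [ x ]≔ just j) ≡ 1#
  weight-single {r} {x} {j} x∈heavy = begin-equality
    weight (∅ [ x ]≔ just j)     ≡⟨ coveredSum-match (lookup w) ∅ {i = x} (lookup-replicate x nothing) ⟩
    weight {r} ∅ + lookup w x    ≡⟨ cong (_+ lookup w x) (coveredSum-empty {r = r} (lookup w)) ⟩
    0# + lookup w x              ≡⟨ +-identityˡ (lookup w x) ⟩
    lookup w x                   ≡⟨ w-heavy x∈heavy ⟩
    1#                           ∎

  -- Playing against an arbitrary algorithm.

  module _ (A : Algorithm) {ρ : ℝ} (competitive : Competitive A ρ) where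
    open Algorithm A

    d₁ : Decision 4
    d₁ = decide w [] heavy

    d₂ : Fin 4 → Decision 4
    d₂ x = decide w (heavy ∷ []) (⁅ x ⁆ ∪ ⁅ 3F ⁆)

    rerouted : ∀ {x i} → x ∈ heavy → i ∈ heavy → i ≢ x →
               d₁ ≡ augment₁ x → d₂ x ≡ augment₃ x i → ρ ≤ κ
    rerouted {x} {i} x∈heavy i∈heavy i≢x d₁≡ d₂≡ = ρ[3+δ]≤2⇒ρ≤κ (begin
      ρ * sum (lookup w)                  ≡⟨ cong (ρ *_) (weight-opt₄ x i) ⟨
      ρ * weight (opt₄ x i)               ≤⟨ competitive I (opt₄ x i) (opt₄-maximum x∈heavy i∈heavy i≢x) ⟩
      weight (final I)                    ≡⟨ final-weight (proj₂ (legal I)) ⟩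
      2#                                  ∎)
      where
      I = arriving (Ns₄ x i)
      M₁ M₂ : Mates 4 4
      M₁ = ∅ [ x ]≔ just 0F
      M₂ = (M₁ [ x ]≔ just 1F) [ i ]≔ just 0F
      weight-M₂ : weight M₂ ≡ 2#
      weight-M₂ = begin-equality
        weight M₂
          ≡⟨ coveredSum-match (lookup w) (M₁ [ x ]≔ just 1F) (trans (lookup∘update′ i≢x M₁ (just 1F))
               (trans (lookup∘update′ i≢x ∅ (just 0F)) (lookup-replicate i nothing))) ⟩
        weight (M₁ [ x ]≔ just 1F) + lookup w i
          ≡⟨ cong (_+ lookup w i) (coveredSum-rematch (lookup w) M₁ (lookup∘update x ∅ (just 0F))) ⟩
        weight M₁ + lookup w i
          ≡⟨ cong (_+ lookup w i) (weight-single x∈heavy) ⟩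
        1# + lookup w i
          ≡⟨ cong (1# +_) (w-heavy i∈heavy) ⟩
        2# ∎
      final-weight : ∀ {σ} → Execution decide I [] initial (Instance.arrivals I) σ →
                     weight (State.M σ) ≡ 2#
      final-weight ex
        with _ , d≡ , _ , s₁ , ex₁ ← peel ex with refl ← trans d≡ d₁≡ with augment₁ _ _ ← s₁
        with _ , d≡ , _ , s₂ , ex₂ ← peel ex₁ with refl ← trans d≡ d₂≡ with augment₃ _ Mx≡ _ _ _ _ ← s₂
        with refl ← just-injective (trans (sym (lookup∘update x ∅ (just 0F))) Mx≡)
        with _ , _ , _ , s₃ , ex₃ ← peel ex₂
        -- The third arrival sees only x, which has spent its reassignment.
        with refl ← only-leave {a = x} refl
               (trans (lookup∘update′ (i≢x ∘ sym) (M₁ [ x ]≔ just 1F) (just 0F)) (lookup∘update x M₁ (just 1F)))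
               (inj₁ (trans (lookup∘updateAt x (replicate 4 0)) (cong ℕ.suc (lookup-replicate x 0)))) s₃
        with _ , _ , _ , s₄ , done ← peel ex₃
        -- The fourth sees only i, whose mate, the first arrival, has spent its own.
        with refl ← only-leave {a = i} refl (lookup∘update i (M₁ [ x ]≔ just 1F) (just 0F)) (inj₂ (inj₁ refl)) s₄
        = weight-M₂

    -- Read off on `Ns₃`. As `d₂ x` depends only on the first two neighbourhoods, a rerouting found
    -- here also occurs on `Ns₄`.
    outcome : ∀ {x σ} → x ∈ heavy → d₁ ≡ augment₁ x →
              Execution decide (arriving (Ns₃ x)) [] initial (Instance.arrivals (arriving (Ns₃ x))) σ →
              (∃[ i ] i ∈ heavy × i ≢ x × d₂ x ≡ augment₃ x i) ⊎ weight (State.M σ) ≤ 1# + δ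
    outcome {x} x∈heavy d₁≡ ex
      with _ , d≡ , _ , s₁ , ex₁ ← peel ex with refl ← trans d≡ d₁≡ with augment₁ _ _ ← s₁
      with _ , d₂≡ , _ , s₂ , ex₂ ← peel ex₁
      with _ , _ , _ , s₃ , done ← peel ex₂ = after s₂ d₂≡ s₃
      where
      M₁ : Mates 4 3
      M₁ = ∅ [ x ]≔ just 0F
      M₁x : lookup M₁ x ≡ just 0F
      M₁x = lookup∘update x ∅ (just 0F)
      x≢3 : x ≢ 3F
      x≢3 refl = 3∉heavy x∈heavy
      M₁3 : lookup M₁ 3F ≡ nothing
      M₁3 = lookup∘update′ (x≢3 ∘ sym) ∅ (just 0F)
      weight-M₁∪3 : ∀ {j} → weight (M₁ [ 3F ]≔ just j) ≤ 1# + δ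
      weight-M₁∪3 = ≤-reflexive (trans (coveredSum-match (lookup w) M₁ M₁3)
        (cong (_+ δ) (weight-single {j = 0F} x∈heavy)))
      member : ∀ {k} → k ∈ ⁅ x ⁆ ∪ ⁅ 3F ⁆ → k ≡ x ⊎ k ≡ 3F
      member k∈ with x∈p∪q⁻ ⁅ x ⁆ ⁅ 3F ⁆ k∈
      ... | inj₁ k∈x = inj₁ (x∈⁅y⁆⇒x≡y x k∈x)
      ... | inj₂ k∈3 = inj₂ (x∈⁅y⁆⇒x≡y 3F k∈3)
      taken : ∀ {k} → k ∈ ⁅ x ⁆ ∪ ⁅ 3F ⁆ → lookup (M₁ [ 3F ]≔ just 1F) k ≢ nothing
      taken k∈ Mk≡ with member k∈
      ... | inj₁ refl = contradiction (trans (sym (trans (lookup∘update′ x≢3 M₁ (just 1F)) M₁x)) Mk≡) λ ()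
      ... | inj₂ refl = contradiction (trans (sym (lookup∘update 3F M₁ (just 1F))) Mk≡) λ ()
      after : ∀ {d d′ σ₂ σ₃} →
              Step 1 1 (graph (Ns₃ x)) 1F (state M₁ (replicate 4 0) (replicate 3 0)) d σ₂ → d ≡ d₂ x →
              Step 1 1 (graph (Ns₃ x)) 2F σ₂ d′ σ₃ →
              (∃[ i ] i ∈ heavy × i ≢ x × d₂ x ≡ augment₃ x i) ⊎ weight (State.M σ₃) ≤ 1# + δ
      after leave _ leave = inj₂ (subst (_≤ 1# + δ) (sym (weight-single {j = 0F} x∈heavy)) (x≤x+y 0≤δ))
      after leave _ (augment₁ i∈ _) with refl ← x∈⁅y⁆⇒x≡y 3F i∈ = inj₂ weight-M₁∪3
      after leave _ (augment₃ z∈ Mz≡ _ _ _ _) with refl ← x∈⁅y⁆⇒x≡y 3F z∈ =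
        contradiction (trans (sym M₁3) Mz≡) λ ()
      after (augment₁ i∈ Mi≡) _ s₃ with member i∈
      ... | inj₁ refl = contradiction (trans (sym M₁x) Mi≡) λ ()
      -- The third arrival sees only the light vertex, held by the second arrival, whose two
      -- neighbours are both matched.
      ... | inj₂ refl with refl ← only-leave {a = 3F} refl (lookup∘update 3F M₁ (just 1F)) (inj₂ (inj₂ taken)) s₃ =
        inj₂ weight-M₁∪3
      after (augment₃ z∈ Mz≡ i∈ Mi≡ _ _) d₂≡ _ with member z∈
      ... | inj₂ refl = contradiction (trans (sym M₁3) Mz≡) λ ()
      ... | inj₁ refl with refl ← just-injective (trans (sym M₁x) Mz≡) =
        inj₁ (_ , i∈ , (λ { refl → contradiction (trans (sym M₁x) Mi≡) λ () }) , sym d₂≡)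

    matched-first : ∀ {x} → x ∈ heavy → d₁ ≡ augment₁ x → ρ ≤ κ
    matched-first {x} x∈heavy d₁≡ with outcome x∈heavy d₁≡ (proj₂ (legal (arriving (Ns₃ x))))
    ... | inj₁ (_ , i∈heavy , i≢x , d₂≡) = rerouted x∈heavy i∈heavy i≢x d₁≡ d₂≡
    ... | inj₂ weight≤ = ρ[2+δ]≤1+δ⇒ρ≤κ (≤-trans
      (subst (λ c → ρ * c ≤ weight (final I)) (weight-opt₃ x) (competitive I (opt₃ x) (opt₃-maximum x∈heavy)))
      weight≤)
      where I = arriving (Ns₃ x)

    upper-bound : ρ ≤ κ
    upper-bound = first (proj₂ (legal (arriving Ns₁)))
      (subst (λ c → ρ * c ≤ weight (final (arriving Ns₁))) weight-opt₁ (competitive (arriving Ns₁) opt₁ opt₁-maximum))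
      where
      first : ∀ {σ} → Execution decide (arriving Ns₁) [] initial (Instance.arrivals (arriving Ns₁)) σ →
              ρ * 1# ≤ weight (State.M σ) → ρ ≤ κ
      first ex bound with peel ex
      ... | _ , d≡ , _ , augment₁ i∈heavy _ , _ = matched-first i∈heavy (sym d≡)
      ... | _ , _ , _ , augment₃ {x = x} _ Mx≡ _ _ _ _ , _ =
        contradiction (trans (sym (lookup-replicate x nothing)) Mx≡) λ ()
      -- With the only arrival unmatched the weight is 0, which forces ρ ≤ 0.
      ... | _ , _ , _ , leave , done = begin
        ρ            ≡⟨ *-identityʳ ρ ⟨
        ρ * 1#       ≤⟨ bound ⟩
        weight {1} ∅ ≡⟨ coveredSum-empty {r = 1} (lookup w) ⟩
        0#           ≤⟨ 0≤κ ⟩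
        κ            ∎

theorem21 : (reals : RealNumbers) →
    let open RealNumbers reals
        open WOMP₃ reals 1 1
    in
    Σ[ √2 ∈ ℝ ] (0# ≤ √2) × (√2 * √2 ≡ 2#) ×
      (Σ[ A ∈ Algorithm ] IsCompetitiveRatio A (2# - √2)) ×
      ((A : Algorithm) (ρ : ℝ) → Competitive A ρ → ρ ≤ 2# - √2)
theorem21 reals =
  √2 , 0≤√2 , √2*√2≡2 ,
  (algorithm , algorithm-competitive , λ _ → upper-bound algorithm) ,
  λ A _ → upper-bound A
  where
  open SilverRatio reals
  open GreedyAlgorithm reals
  open Adversary reals
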